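{- Let $G$ be an $(n,d,\lambda)$-graph and let $B\subseteq V(G)$ with $|B|=m$. Define $$\theta_B := \frac{m}{n}+\frac{\lambda}{d}.$$ Then for all $i\ge 2$, $$c_i(B)\le \frac{m}{i!}\,(d\theta_B)^{i-1}.$$ In particular, for $i=2$, writing $e(B)$ for the number of edges of $G$ with both endpoints in $B$, $$c_2(B)=e(B)\le \frac{dm}{2}\left(\frac{m}{n}+\frac{\lambda}{d}\right).$$
   Context: Graphs are finite and simple. An $(n,d,\lambda)$-graph is a $d$-regular graph on $n$ vertices whose adjacency matrix has eigenvalues $\lambda_1=d\ge\lambda_2\ge\dots\ge\lambda_n\ge -d$ with $|\lambda_i|\le\lambda$ for all $i\ge 2$. For $B\subseteq V(G)$, $c_i(B)$ denotes the number of subsets $K\subseteq B$ with $|K|=i$ that are cliques in $G$. -}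

module Defs where

open import Level using (0ℓ)
open import Algebra.Bundles using (RawRing)
import Algebra.Definitions.RawSemiring as RawSemiringDefs
open import Data.Bool.Base using (if_then_else_)
open import Data.Fin.Base as Fin using (Fin; punchIn)
import Data.Fin.Properties as Fin
open import Data.Fin.Subset using (Subset; inside; outside; _∈_; ∣_∣)
open import Data.Fin.Subset.Properties using (_∈?_; _⊆?_)
open import Data.Integer.Base using (+_)
open import Data.List.Base using (List; []; _∷_; _++_; map; filter; length; allFin; cartesianProduct)
open import Data.Nat.Base as ℕ using (ℕ; zero; suc; NonZero)
import Data.Nat.Properties as ℕ
open import Data.Product using (_×_; _,_; ∃-syntax)
open import Data.Rational.Base as ℚ using (ℚ; 0ℚ; 1ℚ; ½; Positive)
import Data.Rational.Properties as ℚ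
open import Data.Rational.Solver using (module +-*-Solver)
open import Data.Sum.Base using (inj₁; inj₂)
open import Data.Vec.Base as Vec using ([]; _∷_)
open import Relation.Binary.Core using (Rel)
open import Relation.Binary.Definitions using (Decidable; Symmetric; Irreflexive)
open import Relation.Binary.PropositionalEquality
  using (_≡_; _≢_; refl; sym; trans; cong; subst)
open import Relation.Nullary.Decidable using (Dec; does; ¬?; _×-dec_; _→-dec_)

Cauchy : (ℕ → ℚ) → Set
Cauchy x = ∀ ε → 0ℚ ℚ.< ε →
  ∃[ N ] (∀ m n → N ℕ.≤ m → N ℕ.≤ n → ℚ.∣ x m ℚ.- x n ∣ ℚ.< ε)

-- Real numbers are Cauchy sequences of rationals, identified up to _≃_; all
-- operations act termwise.
record ℝ : Set where
  constructor mkℝ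
  field
    seq    : ℕ → ℚ
    cauchy : Cauchy seq

open ℝ public

infix 4 _≃_ _≤_

_≃_ : Rel ℝ 0ℓ
x ≃ y = ∀ ε → 0ℚ ℚ.< ε →
  ∃[ N ] (∀ n → N ℕ.≤ n → ℚ.∣ seq x n ℚ.- seq y n ∣ ℚ.< ε)

_≤_ : Rel ℝ 0ℓ
x ≤ y = ∀ ε → 0ℚ ℚ.< ε →
  ∃[ N ] (∀ n → N ℕ.≤ n → seq x n ℚ.< seq y n ℚ.+ ε)

private
  open +-*-Solver using (solve; _:=_; _:+_; _:*_; _:-_; :-_)
  open ℚ.≤-Reasoning

  ½-pos : ∀ {ε} → 0ℚ ℚ.< ε → 0ℚ ℚ.< ½ ℚ.* ε
  ½-pos {ε} 0<ε = begin-strict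
    0ℚ         ≡⟨ ℚ.*-zeroʳ ½ ⟨
    ½ ℚ.* 0ℚ   <⟨ ℚ.*-monoʳ-<-pos ½ 0<ε ⟩
    ½ ℚ.* ε    ∎

  ½+½ : ∀ ε → ½ ℚ.* ε ℚ.+ ½ ℚ.* ε ≡ ε
  ½+½ ε = trans (sym (ℚ.*-distribʳ-+ ε ½ ½)) (ℚ.*-identityˡ ε)

  reverse-triangle : ∀ p q → ℚ.∣ ℚ.∣ p ∣ ℚ.- ℚ.∣ q ∣ ∣ ℚ.≤ ℚ.∣ p ℚ.- q ∣
  reverse-triangle p q with ℚ.∣p∣≡p∨∣p∣≡-p (ℚ.∣ p ∣ ℚ.- ℚ.∣ q ∣)
  ... | inj₁ eq = begin
    ℚ.∣ ℚ.∣ p ∣ ℚ.- ℚ.∣ q ∣ ∣  ≡⟨ eq ⟩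
    ℚ.∣ p ∣ ℚ.- ℚ.∣ q ∣        ≤⟨ half p q ⟩
    ℚ.∣ p ℚ.- q ∣              ∎
    where
    half : ∀ p q → ℚ.∣ p ∣ ℚ.- ℚ.∣ q ∣ ℚ.≤ ℚ.∣ p ℚ.- q ∣
    half p q = begin
      ℚ.∣ p ∣ ℚ.- ℚ.∣ q ∣
        ≡⟨ cong (λ t → ℚ.∣ t ∣ ℚ.- ℚ.∣ q ∣) (solve 2 (λ p q → p := (p :- q) :+ q) refl p q) ⟩
      ℚ.∣ (p ℚ.- q) ℚ.+ q ∣ ℚ.- ℚ.∣ q ∣
        ≤⟨ ℚ.+-monoˡ-≤ (ℚ.- ℚ.∣ q ∣) (ℚ.∣p+q∣≤∣p∣+∣q∣ (p ℚ.- q) q) ⟩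
      ℚ.∣ p ℚ.- q ∣ ℚ.+ ℚ.∣ q ∣ ℚ.- ℚ.∣ q ∣
        ≡⟨ solve 2 (λ a b → a :+ b :- b := a) refl ℚ.∣ p ℚ.- q ∣ ℚ.∣ q ∣ ⟩
      ℚ.∣ p ℚ.- q ∣ ∎
  ... | inj₂ eq = begin
    ℚ.∣ ℚ.∣ p ∣ ℚ.- ℚ.∣ q ∣ ∣
      ≡⟨ eq ⟩
    ℚ.- (ℚ.∣ p ∣ ℚ.- ℚ.∣ q ∣)
      ≡⟨ cong (λ t → ℚ.- (ℚ.∣ p ∣ ℚ.- ℚ.∣ t ∣)) (solve 2 (λ p q → q := p :+ (:- (p :- q))) refl p q) ⟩
    ℚ.- (ℚ.∣ p ∣ ℚ.- ℚ.∣ p ℚ.+ ℚ.- (p ℚ.- q) ∣)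
      ≡⟨ solve 2 (λ a b → :- (a :- b) := b :- a) refl ℚ.∣ p ∣ ℚ.∣ p ℚ.+ ℚ.- (p ℚ.- q) ∣ ⟩
    ℚ.∣ p ℚ.+ ℚ.- (p ℚ.- q) ∣ ℚ.- ℚ.∣ p ∣
      ≤⟨ ℚ.+-monoˡ-≤ (ℚ.- ℚ.∣ p ∣) (ℚ.∣p+q∣≤∣p∣+∣q∣ p (ℚ.- (p ℚ.- q))) ⟩
    ℚ.∣ p ∣ ℚ.+ ℚ.∣ ℚ.- (p ℚ.- q) ∣ ℚ.- ℚ.∣ p ∣
      ≡⟨ solve 2 (λ a b → a :+ b :- a := b) refl ℚ.∣ p ∣ ℚ.∣ ℚ.- (p ℚ.- q) ∣ ⟩
    ℚ.∣ ℚ.- (p ℚ.- q) ∣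
      ≡⟨ ℚ.∣-p∣≡∣p∣ (p ℚ.- q) ⟩
    ℚ.∣ p ℚ.- q ∣ ∎

  eventually-bounded : ∀ {x} → Cauchy x →
    ∃[ K ] (0ℚ ℚ.< K × ∃[ N ] (∀ n → N ℕ.≤ n → ℚ.∣ x n ∣ ℚ.≤ K))
  eventually-bounded {x} cx with cx 1ℚ (ℚ.positive⁻¹ 1ℚ)
  ... | N , close = 1ℚ ℚ.+ ℚ.∣ x N ∣
    , ℚ.+-mono-<-≤ (ℚ.positive⁻¹ 1ℚ) (ℚ.0≤∣p∣ (x N))
    , N , λ n N≤n → begin
      ℚ.∣ x n ∣
        ≡⟨ cong ℚ.∣_∣ (solve 2 (λ p q → p := (p :- q) :+ q) refl (x n) (x N)) ⟩
      ℚ.∣ (x n ℚ.- x N) ℚ.+ x N ∣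
        ≤⟨ ℚ.∣p+q∣≤∣p∣+∣q∣ (x n ℚ.- x N) (x N) ⟩
      ℚ.∣ x n ℚ.- x N ∣ ℚ.+ ℚ.∣ x N ∣
        ≤⟨ ℚ.+-monoˡ-≤ ℚ.∣ x N ∣ (ℚ.<⇒≤ (close n N N≤n ℕ.≤-refl)) ⟩
      1ℚ ℚ.+ ℚ.∣ x N ∣ ∎

  scaled-≤ : ∀ {a b K δ} → 0ℚ ℚ.< δ → ℚ.∣ a ∣ ℚ.≤ K → ℚ.∣ b ∣ ℚ.< δ →
    ℚ.∣ a ℚ.* b ∣ ℚ.≤ K ℚ.* δ
  scaled-≤ {a} {b} {K} {δ} 0<δ a≤K b<δ = begin
    ℚ.∣ a ℚ.* b ∣        ≡⟨ ℚ.∣p*q∣≡∣p∣*∣q∣ a b ⟩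
    ℚ.∣ a ∣ ℚ.* ℚ.∣ b ∣  ≤⟨ ℚ.*-monoˡ-≤-nonNeg ℚ.∣ a ∣ {{ℚ.∣-∣-nonNeg a}} (ℚ.<⇒≤ b<δ) ⟩
    ℚ.∣ a ∣ ℚ.* δ        ≤⟨ ℚ.*-monoʳ-≤-nonNeg δ {{ℚ.pos⇒nonNeg δ {{ℚ.positive 0<δ}}}} a≤K ⟩
    K ℚ.* δ              ∎

  *-difference : ∀ a b c d →
    a ℚ.* b ℚ.- c ℚ.* d ≡ a ℚ.* (b ℚ.- d) ℚ.+ d ℚ.* (a ℚ.- c)
  *-difference = solve 4 (λ a b c d → a :* b :- c :* d := a :* (b :- d) :+ d :* (a :- c)) refl

  1/-scale : ∀ S T ε → S ℚ.* T ≡ 1ℚ → S ℚ.* (T ℚ.* ε) ≡ ε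
  1/-scale S T ε ST≡1 =
    trans (sym (ℚ.*-assoc S T ε)) (trans (cong (ℚ._* ε) ST≡1) (ℚ.*-identityˡ ε))

  inverse : ∀ S → 0ℚ ℚ.< S → ∃[ T ] (0ℚ ℚ.< T × S ℚ.* T ≡ 1ℚ)
  inverse S 0<S = ℚ.1/ S , ℚ.positive⁻¹ (ℚ.1/ S) {{ℚ.1/pos⇒pos S}} , ℚ.*-inverseʳ S
    where
    instance
      S-pos : Positive S
      S-pos = ℚ.positive 0<S
      S-nonZero : ℚ.NonZero S
      S-nonZero = ℚ.pos⇒nonZero S

  small : ∀ K L ε → 0ℚ ℚ.< K ℚ.+ L → 0ℚ ℚ.< ε →
    ∃[ δ ] (0ℚ ℚ.< δ × K ℚ.* δ ℚ.+ L ℚ.* δ ℚ.< ε)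
  small K L ε 0<S 0<ε with inverse (K ℚ.+ L) 0<S | ℚ.<-dense 0<ε
  ... | T , 0<T , ST≡1 | η , 0<η , η<ε =
    T ℚ.* η
    , ℚ.positive⁻¹ (T ℚ.* η) {{ℚ.pos*pos⇒pos T {{ℚ.positive 0<T}} η {{ℚ.positive 0<η}}}}
    , subst (ℚ._< ε)
        (sym (trans (sym (ℚ.*-distribʳ-+ (T ℚ.* η) K L)) (1/-scale (K ℚ.+ L) T η ST≡1))) η<ε

  *-close : ∀ {a b c d K L δ ε} → 0ℚ ℚ.< δ → K ℚ.* δ ℚ.+ L ℚ.* δ ℚ.< ε →
    ℚ.∣ a ∣ ℚ.≤ K → ℚ.∣ d ∣ ℚ.≤ L → ℚ.∣ b ℚ.- d ∣ ℚ.< δ → ℚ.∣ a ℚ.- c ∣ ℚ.< δ →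
    ℚ.∣ a ℚ.* b ℚ.- c ℚ.* d ∣ ℚ.< ε
  *-close {a} {b} {c} {d} {K} {L} {δ} {ε} 0<δ small-δ a≤K d≤L b-d a-c = begin-strict
    ℚ.∣ a ℚ.* b ℚ.- c ℚ.* d ∣
      ≡⟨ cong ℚ.∣_∣ (*-difference a b c d) ⟩
    ℚ.∣ a ℚ.* (b ℚ.- d) ℚ.+ d ℚ.* (a ℚ.- c) ∣
      ≤⟨ ℚ.∣p+q∣≤∣p∣+∣q∣ (a ℚ.* (b ℚ.- d)) (d ℚ.* (a ℚ.- c)) ⟩
    ℚ.∣ a ℚ.* (b ℚ.- d) ∣ ℚ.+ ℚ.∣ d ℚ.* (a ℚ.- c) ∣
      ≤⟨ ℚ.+-mono-≤ (scaled-≤ {a} {b ℚ.- d} 0<δ a≤K b-d) (scaled-≤ {d} {a ℚ.- c} 0<δ d≤L a-c) ⟩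
    K ℚ.* δ ℚ.+ L ℚ.* δ
      <⟨ small-δ ⟩
    ε ∎

-- The convergence proofs carry no information about the real they belong to
-- (_≃_ and _≤_ only look at the sequence), so they are kept from unfolding.
abstract
  +-cauchy : ∀ x y → Cauchy x → Cauchy y → Cauchy (λ n → x n ℚ.+ y n)
  +-cauchy x y cx cy ε 0<ε with cx (½ ℚ.* ε) (½-pos 0<ε) | cy (½ ℚ.* ε) (½-pos 0<ε)
  ... | M , cM | N , cN = M ℕ.⊔ N , λ m n ≤m ≤n → begin-strict
    ℚ.∣ (x m ℚ.+ y m) ℚ.- (x n ℚ.+ y n) ∣
      ≡⟨ cong ℚ.∣_∣ (solve 4 (λ a b c d → (a :+ b) :- (c :+ d) := (a :- c) :+ (b :- d))
                       refl (x m) (y m) (x n) (y n)) ⟩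
    ℚ.∣ (x m ℚ.- x n) ℚ.+ (y m ℚ.- y n) ∣
      ≤⟨ ℚ.∣p+q∣≤∣p∣+∣q∣ (x m ℚ.- x n) (y m ℚ.- y n) ⟩
    ℚ.∣ x m ℚ.- x n ∣ ℚ.+ ℚ.∣ y m ℚ.- y n ∣
      <⟨ ℚ.+-mono-< (cM m n (ℕ.m⊔n≤o⇒m≤o M N ≤m) (ℕ.m⊔n≤o⇒m≤o M N ≤n))
                    (cN m n (ℕ.m⊔n≤o⇒n≤o M N ≤m) (ℕ.m⊔n≤o⇒n≤o M N ≤n)) ⟩
    ½ ℚ.* ε ℚ.+ ½ ℚ.* ε
      ≡⟨ ½+½ ε ⟩
    ε ∎

  neg-cauchy : ∀ x → Cauchy x → Cauchy (λ n → ℚ.- x n)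
  neg-cauchy x cx ε 0<ε with cx ε 0<ε
  ... | N , cN = N , λ m n ≤m ≤n → begin-strict
    ℚ.∣ ℚ.- x m ℚ.- (ℚ.- x n) ∣  ≡⟨ cong ℚ.∣_∣ (solve 2 (λ a b → :- a :- (:- b) := :- (a :- b)) refl (x m) (x n)) ⟩
    ℚ.∣ ℚ.- (x m ℚ.- x n) ∣      ≡⟨ ℚ.∣-p∣≡∣p∣ (x m ℚ.- x n) ⟩
    ℚ.∣ x m ℚ.- x n ∣            <⟨ cN m n ≤m ≤n ⟩
    ε                            ∎

  abs-cauchy : ∀ x → Cauchy x → Cauchy (λ n → ℚ.∣ x n ∣)
  abs-cauchy x cx ε 0<ε with cx ε 0<ε
  ... | N , cN = N , λ m n ≤m ≤n →
    ℚ.≤-<-trans (reverse-triangle (x m) (x n)) (cN m n ≤m ≤n)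

  *-cauchy : ∀ x y → Cauchy x → Cauchy y → Cauchy (λ n → x n ℚ.* y n)
  *-cauchy x y cx cy ε 0<ε =
    let K , 0<K , Nx , bx = eventually-bounded cx
        L , 0<L , Ny , by = eventually-bounded cy
        δ , 0<δ , small-δ = small K L ε (ℚ.+-mono-< 0<K 0<L) 0<ε
        Mx , cMx          = cx δ 0<δ
        My , cMy          = cy δ 0<δ
        N₁ = Nx ℕ.⊔ Ny
        N₂ = Mx ℕ.⊔ My
    in N₁ ℕ.⊔ N₂ , λ m n ≤m ≤n →
      let N₂≤m = ℕ.m⊔n≤o⇒n≤o N₁ N₂ ≤m
          N₂≤n = ℕ.m⊔n≤o⇒n≤o N₁ N₂ ≤n
      in *-close {x m} {y m} {x n} {y n} 0<δ small-δ
           (bx m (ℕ.m⊔n≤o⇒m≤o Nx Ny (ℕ.m⊔n≤o⇒m≤o N₁ N₂ ≤m)))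
           (by n (ℕ.m⊔n≤o⇒n≤o Nx Ny (ℕ.m⊔n≤o⇒m≤o N₁ N₂ ≤n)))
           (cMy m n (ℕ.m⊔n≤o⇒n≤o Mx My N₂≤m) (ℕ.m⊔n≤o⇒n≤o Mx My N₂≤n))
           (cMx m n (ℕ.m⊔n≤o⇒m≤o Mx My N₂≤m) (ℕ.m⊔n≤o⇒m≤o Mx My N₂≤n))

  const-cauchy : ∀ q → Cauchy (λ _ → q)
  const-cauchy q ε 0<ε = 0 , λ _ _ _ _ → subst (ℚ._< ε) (sym (cong ℚ.∣_∣ (ℚ.+-inverseʳ q))) 0<ε

infix  8 -_
infixl 7 _*_ _÷_
infixl 6 _+_ _-_

fromℚ : ℚ → ℝ
fromℚ q = mkℝ (λ _ → q) (const-cauchy q)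

fromℕ : ℕ → ℝ
fromℕ n = fromℚ (+ n ℚ./ 1)

_+_ _*_ : ℝ → ℝ → ℝ
x + y = mkℝ (λ n → seq x n ℚ.+ seq y n) (+-cauchy (seq x) (seq y) (cauchy x) (cauchy y))
x * y = mkℝ (λ n → seq x n ℚ.* seq y n) (*-cauchy (seq x) (seq y) (cauchy x) (cauchy y))

-_ abs : ℝ → ℝ
- x   = mkℝ (λ n → ℚ.- seq x n) (neg-cauchy (seq x) (cauchy x))
abs x = mkℝ (λ n → ℚ.∣ seq x n ∣) (abs-cauchy (seq x) (cauchy x))

_-_ : ℝ → ℝ → ℝ
x - y = x + (- y)

_÷_ : ℝ → (k : ℕ) .{{_ : NonZero k}} → ℝ
x ÷ k = x * fromℚ (+ 1 ℚ./ k)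

0ℝ 1ℝ : ℝ
0ℝ = fromℕ 0
1ℝ = fromℕ 1

ℝ-rawRing : RawRing 0ℓ 0ℓ
ℝ-rawRing = record
  { Carrier = ℝ ; _≈_ = _≃_ ; _+_ = _+_ ; _*_ = _*_ ; -_ = -_ ; 0# = 0ℝ ; 1# = 1ℝ }

open RawSemiringDefs (RawRing.rawSemiring ℝ-rawRing) public using (_^_; sum; product)

Matrix : ℕ → Set
Matrix n = Fin n → Fin n → ℝ

-- Laplace expansion along the first row.
det : ∀ {n} → Matrix n → ℝ
det {zero}  M = 1ℝ
det {suc n} M = sum λ j →
  (- 1ℝ) ^ Fin.toℕ j * M Fin.zero j * det (λ i k → M (Fin.suc i) (punchIn j k))

identity : ∀ {n} → Matrix n
identity i j = if does (i Fin.≟ j) then 1ℝ else 0ℝ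

-- The value at x of the characteristic polynomial, det (x I − A).
charPoly : ∀ {n} → Matrix n → ℝ → ℝ
charPoly A x = det (λ i j → x * identity i j - A i j)

-- μ lists the eigenvalues of A with (algebraic) multiplicity: the
-- characteristic polynomial is ∏ᵢ (x − μᵢ).  Since ℝ is infinite, equality of
-- the two polynomials is equality of their values.
IsSpectrum : ∀ {n} → Matrix n → (Fin n → ℝ) → Set
IsSpectrum A μ = ∀ x → charPoly A x ≃ product (λ i → x - μ i)

record Graph (n : ℕ) : Set₁ where
  infix 4 _~_ _~?_
  field
    _~_    : Rel (Fin n) 0ℓ
    _~?_   : Decidable _~_
    ~-sym  : Symmetric _~_
    ~-irrefl : Irreflexive _≡_ _~_

module _ {n : ℕ} (G : Graph n) where
  open Graph G

  neighbours : Fin n → Subset n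
  neighbours v = Vec.tabulate (λ w → does (v ~? w))

  degree : Fin n → ℕ
  degree v = ∣ neighbours v ∣

  adjacency : Matrix n
  adjacency v w = if does (v ~? w) then 1ℝ else 0ℝ

  -- The eigenvalues are indexed from zero, so λ₁ is `eigenvalue zero`.
  record IsNDΛGraph (d : ℕ) (Λ : ℝ) : Set where
    field
      regular     : ∀ v → degree v ≡ d
      eigenvalue  : Fin n → ℝ
      isSpectrum  : IsSpectrum adjacency eigenvalue
      first       : ∀ i → Fin.toℕ i ≡ 0 → eigenvalue i ≃ fromℕ d
      decreasing  : ∀ i j → i Fin.≤ j → eigenvalue j ≤ eigenvalue i
      lower-bound : ∀ i → - fromℕ d ≤ eigenvalue i
      nontrivial  : ∀ i → 1 ℕ.≤ Fin.toℕ i → abs (eigenvalue i) ≤ Λ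

  IsClique : Subset n → Set
  IsClique K = ∀ v w → v ∈ K → w ∈ K → v ≢ w → v ~ w

  isClique? : ∀ K → Dec (IsClique K)
  isClique? K = Fin.all? λ v → Fin.all? λ w →
    (v ∈? K) →-dec (w ∈? K) →-dec ¬? (v Fin.≟ w) →-dec (v ~? w)

-- Every subset of Fin n exactly once.
subsets : ∀ n → List (Subset n)
subsets zero    = [] ∷ []
subsets (suc n) = map (outside ∷_) (subsets n) ++ map (inside ∷_) (subsets n)

cliqueCount : ∀ {n} → Graph n → ℕ → Subset n → ℕ
cliqueCount {n} G i B =
  length (filter (λ K → (K ⊆? B) ×-dec (∣ K ∣ ℕ.≟ i) ×-dec isClique? G K) (subsets n))

-- Each edge {v , w} is counted once, as the ordered pair with v < w.
edgeCount : ∀ {n} → Graph n → Subset n → ℕ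
edgeCount {n} G B =
  length (filter (λ (v , w) → (v Fin.<? w) ×-dec (v ~? w) ×-dec (v ∈? B) ×-dec (w ∈? B))
                 (cartesianProduct (allFin n) (allFin n)))
  where open Graph G

θ : (n d : ℕ) .{{_ : NonZero n}} .{{_ : NonZero d}} → ℝ → ℕ → ℝ
θ n d Λ m = fromℕ m ÷ n + Λ ÷ d

{-# OPTIONS --safe #-}

-- The second eigenvalue enters through the deflated matrix M = A − (d/n) J of the adjacency
-- matrix A, for which det (t I − M) = t ∏_{i ≥ 2} (t − μᵢ).  For t > L > max_{i ≥ 2} μᵢ this
-- determinant is bounded away from 0, and Cramer's rule turns such a bound into: if t I − M is
-- positive semidefinite then so is (t − η) I − M, with η > 0 independent of t.  Descending
-- from a large t gives xᵀ M x ≤ L |x|², and at the indicator of B this bounds the number of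
-- edges inside B.  The clique count follows by induction: every (i + 1)-clique in B is counted
-- once for each of its vertices v, as an i-clique in the part of B adjacent to v.
module Submission where

open import Data.Nat.Base as ℕ using (ℕ; zero; suc)
import Data.Nat.Properties as ℕ
open import Data.Product using (_×_; _,_; proj₁; proj₂; ∃-syntax)
open import Data.Sum.Base using (inj₁; inj₂)
open import Function.Base using (_∘_; id; case_of_)
open import Relation.Binary.PropositionalEquality
open import Relation.Nullary.Decidable using (Dec; does; yes; no; _×-dec_; dec-true; dec-false)
open import Relation.Nullary.Negation using (contradiction)

-- The adjacency matrix is rational, while eigenvalues are Cauchy sequences whose order is not
-- decidable. All linear algebra therefore takes place over ℚ, and no eigenvector is ever produced.
-- The spectrum enters only at rational t: there the products ∏ᵢ (t - μᵢ), formed from the k-th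
-- terms of the eigenvalues, converge to the rational number det (t I - A). Such convergence gives
-- lower bounds for a determinant but locates no root, so the descent takes finitely many steps of a
-- uniform size η instead of appealing to an intermediate value. One point escapes. Both det (t I -
-- A) and its approximations carry a factor tending to t - d; dividing it out costs a tolerance
-- proportional to |t - d|, so nothing is learnt at t = d itself and the descent must step around
-- that point. Since λ is only approximated, it is replaced by a rational L with L ≤ λ + δ that
-- still exceeds every nontrivial eigenvalue. The final inequality allows an error ε, and δ is
-- chosen from ε by continuity of the power.

module Determinant where

  open import Algebra.Bundles using (CommutativeRing)
  open import Data.Fin.Base using (Fin; zero; suc; toℕ; inject₁; punchIn; _≤_)
  open import Data.Fin.Properties using (toℕ-inject₁; suc-injective)
  open import Data.Nat.Base using (z≤n; s≤s)
  open import Data.Rational.Base hiding (_≤_)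
  open import Data.Rational.Properties
  open import Data.Rational.Solver using (module +-*-Solver)
  open import Data.Vec.Functional using (_∷_)

  open import Algebra.Properties.Semiring.Sum (CommutativeRing.semiring +-*-commutativeRing) public
    using (sum; ∑-distrib-+; ∑-comm; *-distribˡ-sum; *-distribʳ-sum; sum-cong-≗; sum-replicate-zero; sum-remove)
  open import Algebra.Properties.Semiring.Exp (CommutativeRing.semiring +-*-commutativeRing) public
    using (_^_)
  open +-*-Solver using (solve; _:=_; _:+_; _:*_; _:-_; :-_; con)

  -- Alternating multilinear functions of the rows of a matrix

  Vec : ℕ → Set
  Vec n = Fin n → ℚ

  Rows : ℕ → ℕ → Set
  Rows k n = Fin k → Vec n

  infix 4 _≋_
  _≋_ : ∀ {k n} → Rows k n → Rows k n → Set
  R ≋ S = ∀ i j → R i j ≡ S i j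

  sum-zero : ∀ {n} {f : Vec n} → (∀ i → f i ≡ 0ℚ) → sum f ≡ 0ℚ
  sum-zero {n} f≡0 = trans (sum-cong-≗ f≡0) (sum-replicate-zero n)

  sign : ∀ {n} → Fin n → ℚ
  sign j = (- 1ℚ) ^ toℕ j

  axpy : ∀ {n} → ℚ → Vec n → Vec n → Vec n
  axpy a u v j = a * u j + v j

  -- The number k of rows is kept apart from their length n so that fixing the top row leaves a
  -- function of the same kind, which drives the inductions below. Linearity relates three matrices
  -- that agree off row i, which avoids a row-update operation. Vanishing is asked only for adjacent
  -- equal rows, the case that Laplace expansion yields directly.
  record Alternating {k n} (F : Rows k n → ℚ) : Set where
    field
      F-cong   : ∀ {R S} → R ≋ S → F R ≡ F S
      linear   : ∀ i a {R S T} → (∀ j → R i j ≡ a * S i j + T i j) →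
                 (∀ l → l ≢ i → R l ≗ S l) → (∀ l → l ≢ i → R l ≗ T l) →
                 F R ≡ a * F S + F T
      adjacent : ∀ i j → toℕ j ≡ suc (toℕ i) → ∀ {R} → R i ≗ R j → F R ≡ 0ℚ

  ∷-cong : ∀ {k n} {v w : Vec n} {R S : Rows k n} → v ≗ w → R ≋ S → v ∷ R ≋ w ∷ S
  ∷-cong v≗w R≋S zero    = v≗w
  ∷-cong v≗w R≋S (suc i) = R≋S i

  head∷tail : ∀ {k n} (R : Rows (suc k) n) → R ≋ R zero ∷ (R ∘ suc)
  head∷tail R zero    j = refl
  head∷tail R (suc i) j = refl

  module _ {k n} {F : Rows (suc k) n → ℚ} (alt : Alternating F) where
    open Alternating alt

    alternating-tail : ∀ v → Alternating (λ T → F (v ∷ T))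
    alternating-tail v = record
      { F-cong   = λ R≋S → F-cong (∷-cong (λ _ → refl) R≋S)
      ; linear   = λ i a eq R≗S R≗T → linear (suc i) a eq (off R≗S) (off R≗T)
      ; adjacent = λ i j eq → adjacent (suc i) (suc j) (cong suc eq)
      }
      where
      off : ∀ {i} {R S : Rows k n} → (∀ l → l ≢ i → R l ≗ S l) →
            ∀ l → l ≢ suc i → (v ∷ R) l ≗ (v ∷ S) l
      off R≗S zero    _   _ = refl
      off R≗S (suc l) l≢i   = R≗S l (l≢i ∘ cong suc)

    linear-head : ∀ a u v T → F (axpy a u v ∷ T) ≡ a * F (u ∷ T) + F (v ∷ T)
    linear-head a u v T = linear zero a (λ _ → refl) off off
      where
      off : ∀ {v w : Vec n} l → l ≢ zero → (v ∷ T) l ≗ (w ∷ T) l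
      off zero    0≢0 = contradiction refl 0≢0
      off (suc l) _ _ = refl

    -- Linearity with coefficient -1 gives z = -z + z.
    zero-head : ∀ T → F ((λ _ → 0ℚ) ∷ T) ≡ 0ℚ
    zero-head T = begin
      z                                       ≡⟨ F-cong (∷-cong (λ _ → refl) (λ _ _ → refl)) ⟩
      F (axpy (- 1ℚ) (λ _ → 0ℚ) (λ _ → 0ℚ) ∷ T) ≡⟨ linear-head (- 1ℚ) (λ _ → 0ℚ) (λ _ → 0ℚ) T ⟩
      - 1ℚ * z + z                            ≡⟨ solve 1 (λ z → con (- 1ℚ) :* z :+ z := con 0ℚ) refl z ⟩
      0ℚ                                      ∎
      where
      open ≡-Reasoning
      z = F ((λ _ → 0ℚ) ∷ T)

    sum-head : ∀ {m} (c : Vec m) (R : Rows m n) T →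
               F ((λ j → sum λ i → c i * R i j) ∷ T) ≡ sum λ i → c i * F (R i ∷ T)
    sum-head {zero}  c R T = zero-head T
    sum-head {suc m} c R T = begin
      F (axpy (c zero) (R zero) (λ j → sum λ i → c (suc i) * R (suc i) j) ∷ T)
        ≡⟨ linear-head (c zero) (R zero) _ T ⟩
      c zero * F (R zero ∷ T) + F ((λ j → sum λ i → c (suc i) * R (suc i) j) ∷ T)
        ≡⟨ cong (c zero * F (R zero ∷ T) +_) (sum-head (c ∘ suc) (R ∘ suc) T) ⟩
      c zero * F (R zero ∷ T) + sum (λ i → c (suc i) * F (R (suc i) ∷ T))
        ∎
      where open ≡-Reasoning

  module _ {k n} {F : Rows (suc (suc k)) n → ℚ} (alt : Alternating F) where
    open Alternating alt
    private
      pair : Vec n → Vec n → Rows k n → ℚ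
      pair u v T = F (u ∷ (v ∷ T))

      equal : ∀ u T → pair u u T ≡ 0ℚ
      equal u T = adjacent zero (suc zero) refl (λ _ → refl)

    -- Polarisation: F vanishes when both top rows are u + v, and of the four terms of its expansion
    -- the two with equal rows vanish as well.
    swap : ∀ u v T → F (u ∷ (v ∷ T)) ≡ - F (v ∷ (u ∷ T))
    swap u v T = begin
      pair u v T
        ≡⟨ solve 4 (λ uu uv vu vv → uv :=
             (con 1ℚ :* (con 1ℚ :* uu :+ uv) :+ (con 1ℚ :* vu :+ vv)) :- uu :- vv :- vu)
           refl (pair u u T) (pair u v T) (pair v u T) (pair v v T) ⟩
      1ℚ * (1ℚ * pair u u T + pair u v T) + (1ℚ * pair v u T + pair v v T)
        - pair u u T - pair v v T - pair v u T
        ≡⟨ cong₂ (λ x y → x - pair u u T - y - pair v u T) expand (equal v T) ⟩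
      0ℚ - pair u u T - 0ℚ - pair v u T
        ≡⟨ cong (λ x → 0ℚ - x - 0ℚ - pair v u T) (equal u T) ⟩
      0ℚ - 0ℚ - 0ℚ - pair v u T
        ≡⟨ +-identityˡ (- pair v u T) ⟩
      - pair v u T ∎
      where
      open ≡-Reasoning
      w = axpy 1ℚ u v
      expand : 1ℚ * (1ℚ * pair u u T + pair u v T) + (1ℚ * pair v u T + pair v v T) ≡ 0ℚ
      expand = begin
        1ℚ * (1ℚ * pair u u T + pair u v T) + (1ℚ * pair v u T + pair v v T)
          ≡⟨ cong₂ (λ x y → 1ℚ * x + y) (linear-head (alternating-tail alt u) 1ℚ u v T)
               (linear-head (alternating-tail alt v) 1ℚ u v T) ⟨
        1ℚ * pair u w T + pair v w T
          ≡⟨ linear-head alt 1ℚ u v (w ∷ T) ⟨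
        pair w w T
          ≡⟨ equal w T ⟩
        0ℚ ∎

  -- The top row is swapped downwards until it meets its copy.
  repeated : ∀ {k n} {F : Rows (suc k) n → ℚ} → Alternating F →
             ∀ v T i → v ≗ T i → F (v ∷ T) ≡ 0ℚ
  repeated alt v T zero v≗T = Alternating.adjacent alt zero (suc zero) refl v≗T
  repeated {F = F} alt v T (suc i) v≗T = begin
    F (v ∷ T)                         ≡⟨ F-cong (∷-cong (λ _ → refl) (head∷tail T)) ⟩
    F (v ∷ (T zero ∷ (T ∘ suc)))      ≡⟨ swap alt v (T zero) (T ∘ suc) ⟩
    - F (T zero ∷ (v ∷ (T ∘ suc)))    ≡⟨ cong -_ (repeated (alternating-tail alt (T zero)) v (T ∘ suc) i v≗T) ⟩
    0ℚ                                ∎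
    where
    open ≡-Reasoning
    open Alternating alt

  -- Row j passes the j rows above it, with one change of sign for each. This is where the signs in
  -- Cramer's rule come from.
  move-to-front : ∀ {k n} {F : Rows (suc k) n → ℚ} → Alternating F →
                  ∀ R j → F (R j ∷ (R ∘ punchIn j)) ≡ sign j * F R
  move-to-front {F = F} alt R zero =
    trans (F-cong λ { zero _ → refl ; (suc i) _ → refl }) (sym (*-identityˡ (F R)))
    where open Alternating alt
  move-to-front {suc k} {F = F} alt R (suc j) = begin
    F (R (suc j) ∷ (R ∘ punchIn (suc j)))
      ≡⟨ F-cong (∷-cong (λ _ → refl) (head∷tail (R ∘ punchIn (suc j)))) ⟩
    F (R (suc j) ∷ (R zero ∷ (R ∘ suc ∘ punchIn j)))
      ≡⟨ swap alt _ _ _ ⟩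
    - F (R zero ∷ (R (suc j) ∷ (R ∘ suc ∘ punchIn j)))
      ≡⟨ cong -_ (move-to-front (alternating-tail alt (R zero)) (R ∘ suc) j) ⟩
    - (sign j * F (R zero ∷ (R ∘ suc)))
      ≡⟨ cong (λ x → - (sign j * x)) (F-cong (head∷tail R)) ⟨
    - (sign j * F R)
      ≡⟨ solve 2 (λ s x → :- (s :* x) := (con (- 1ℚ) :* s) :* x) refl (sign j) (F R) ⟩
    sign (suc j) * F R ∎
    where
    open ≡-Reasoning
    open Alternating alt

  -- Once the second row is cleared, v is swapped below it so that the induction applies with that
  -- row fixed, and is then swapped back; the two signs cancel.
  add-head : ∀ {k n} {F : Rows (suc k) n → ℚ} → Alternating F →
             ∀ v (c : Vec k) T → F (v ∷ λ i → axpy (c i) v (T i)) ≡ F (v ∷ T)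
  add-head {zero}  alt v c T = Alternating.F-cong alt (∷-cong (λ _ → refl) λ ())
  add-head {suc k} {F = F} alt v c T = begin
    F (v ∷ λ i → axpy (c i) v (T i))
      ≡⟨ F-cong (∷-cong (λ _ → refl) (head∷tail _)) ⟩
    F (v ∷ (axpy (c zero) v (T zero) ∷ T⁺))
      ≡⟨ linear-head (alternating-tail alt v) (c zero) v (T zero) T⁺ ⟩
    c zero * F (v ∷ (v ∷ T⁺)) + F (v ∷ (T zero ∷ T⁺))
      ≡⟨ cong₂ (λ x y → c zero * x + y) (adjacent zero (suc zero) refl (λ _ → refl)) (swap alt v (T zero) T⁺) ⟩
    c zero * 0ℚ - F (T zero ∷ (v ∷ T⁺))
      ≡⟨ cong (λ x → c zero * 0ℚ - x) (add-head (alternating-tail alt (T zero)) v (c ∘ suc) (T ∘ suc)) ⟩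
    c zero * 0ℚ - F (T zero ∷ (v ∷ (T ∘ suc)))
      ≡⟨ cong (λ x → c zero * 0ℚ - x) (swap alt (T zero) v (T ∘ suc)) ⟩
    c zero * 0ℚ - (- F (v ∷ (T zero ∷ (T ∘ suc))))
      ≡⟨ solve 2 (λ c x → c :* con 0ℚ :- (:- x) := x) refl (c zero) _ ⟩
    F (v ∷ (T zero ∷ (T ∘ suc)))
      ≡⟨ F-cong (∷-cong (λ _ → refl) (head∷tail T)) ⟨
    F (v ∷ T) ∎
    where
    open ≡-Reasoning
    open Alternating alt
    T⁺ = λ i → axpy (c (suc i)) v (T (suc i))

  -- Every summand of the new top row except the original one repeats a row below it.
  sum-of-rows : ∀ {k n} {F : Rows (suc k) n → ℚ} → Alternating F →
                ∀ R → F ((λ j → sum λ i → R i j) ∷ (R ∘ suc)) ≡ F R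
  sum-of-rows {F = F} alt R = begin
    F ((λ j → sum λ i → R i j) ∷ (R ∘ suc))
      ≡⟨ F-cong (∷-cong (λ j → sum-cong-≗ λ i → sym (*-identityˡ (R i j))) (λ _ _ → refl)) ⟩
    F ((λ j → sum λ i → 1ℚ * R i j) ∷ (R ∘ suc))
      ≡⟨ sum-head alt (λ _ → 1ℚ) R (R ∘ suc) ⟩
    1ℚ * F (R zero ∷ (R ∘ suc)) + sum (λ i → 1ℚ * F (R (suc i) ∷ (R ∘ suc)))
      ≡⟨ cong₂ (λ x y → 1ℚ * x + y) (sym (F-cong (head∷tail R)))
           (sum-zero λ i → trans (*-identityˡ _) (repeated alt (R (suc i)) (R ∘ suc) i (λ _ → refl))) ⟩
    1ℚ * F R + 0ℚ
      ≡⟨ solve 1 (λ x → con 1ℚ :* x :+ con 0ℚ := x) refl (F R) ⟩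
    F R ∎
    where
    open ≡-Reasoning
    open Alternating alt

  -- The determinant is alternating

  minor : ∀ {n} → Rows (suc n) (suc n) → Fin (suc n) → Rows n n
  minor M j i k = M (suc i) (punchIn j k)

  -- The same expansion as for real matrices, so that the k-th term of a real determinant is this
  -- determinant of the k-th terms (`seq-det`).
  det : ∀ {n} → Rows n n → ℚ
  det {zero}  M = 1ℚ
  det {suc n} M = sum λ j → sign j * M zero j * det (minor M j)

  det-cong : ∀ {n} {R S : Rows n n} → R ≋ S → det R ≡ det S
  det-cong {zero}  R≋S = refl
  det-cong {suc n} R≋S = sum-cong-≗ λ j →
    cong₂ (λ x y → sign j * x * y) (R≋S zero j) (det-cong λ i k → R≋S (suc i) (punchIn j k))

  sum-linear : ∀ {n} a {f g h : Vec n} → (∀ i → f i ≡ a * g i + h i) → sum f ≡ a * sum g + sum h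
  sum-linear a {f} {g} {h} eq = begin
    sum f                              ≡⟨ sum-cong-≗ eq ⟩
    sum (λ i → a * g i + h i)          ≡⟨ ∑-distrib-+ (λ i → a * g i) h ⟩
    sum (λ i → a * g i) + sum h        ≡⟨ cong (_+ sum h) (*-distribˡ-sum a g) ⟨
    a * sum g + sum h                  ∎
    where open ≡-Reasoning

  det-linear : ∀ {n} (i : Fin n) a {R S T : Rows n n} → (∀ j → R i j ≡ a * S i j + T i j) →
               (∀ l → l ≢ i → R l ≗ S l) → (∀ l → l ≢ i → R l ≗ T l) →
               det R ≡ a * det S + det T
  det-linear zero a {R} {S} {T} eq R≗S R≗T = sum-linear a λ j → begin
    sign j * R zero j * det (minor R j)
      ≡⟨ cong (λ x → sign j * x * det (minor R j)) (eq j) ⟩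
    sign j * (a * S zero j + T zero j) * det (minor R j)
      ≡⟨ solve 5 (λ s a x y d → s :* (a :* x :+ y) :* d := a :* (s :* x :* d) :+ s :* y :* d)
           refl (sign j) a (S zero j) (T zero j) (det (minor R j)) ⟩
    a * (sign j * S zero j * det (minor R j)) + sign j * T zero j * det (minor R j)
      ≡⟨ cong₂ (λ x y → a * (sign j * S zero j * x) + sign j * T zero j * y)
           (det-cong λ l k → R≗S (suc l) (λ ()) _) (det-cong λ l k → R≗T (suc l) (λ ()) _) ⟩
    a * (sign j * S zero j * det (minor S j)) + sign j * T zero j * det (minor T j) ∎
    where open ≡-Reasoning

  det-linear (suc i) a {R} {S} {T} eq R≗S R≗T = sum-linear a λ j → begin
    sign j * R zero j * det (minor R j)
      ≡⟨ cong (sign j * R zero j *_) (det-linear i a (λ k → eq (punchIn j k))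
           (λ l l≢i k → R≗S (suc l) (l≢i ∘ suc-injective) _)
           (λ l l≢i k → R≗T (suc l) (l≢i ∘ suc-injective) _)) ⟩
    sign j * R zero j * (a * det (minor S j) + det (minor T j))
      ≡⟨ solve 5 (λ s a x d e → s :* x :* (a :* d :+ e) := a :* (s :* x :* d) :+ s :* x :* e)
           refl (sign j) a (R zero j) (det (minor S j)) (det (minor T j)) ⟩
    a * (sign j * R zero j * det (minor S j)) + sign j * R zero j * det (minor T j)
      ≡⟨ cong₂ (λ x y → a * (sign j * x * det (minor S j)) + sign j * y * det (minor T j))
           (R≗S zero (λ ()) j) (R≗T zero (λ ()) j) ⟩
    a * (sign j * S zero j * det (minor S j)) + sign j * T zero j * det (minor T j) ∎
    where open ≡-Reasoning

  -- The pairs (j , punchIn j k) of distinct columns cancel against their mirror images.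
  sum-antisymmetric : ∀ {n} (f : Fin (suc n) → Fin n → ℚ) →
                      (∀ j k → j ≤ k → f (inject₁ j) k + f (suc k) j ≡ 0ℚ) →
                      sum (λ j → sum (f j)) ≡ 0ℚ
  sum-antisymmetric {zero}  f anti = refl
  sum-antisymmetric {suc n} f anti = begin
    sum (f zero) + sum (λ j → f (suc j) zero + sum (λ k → f (suc j) (suc k)))
      ≡⟨ cong (sum (f zero) +_) (∑-distrib-+ (λ j → f (suc j) zero) (λ j → sum λ k → f (suc j) (suc k))) ⟩
    sum (f zero) + (sum (λ j → f (suc j) zero) + rest)
      ≡⟨ +-assoc (sum (f zero)) _ rest ⟨
    sum (f zero) + sum (λ j → f (suc j) zero) + rest
      ≡⟨ cong₂ _+_ (trans (sym (∑-distrib-+ (f zero) (λ j → f (suc j) zero))) (sum-zero λ k → anti zero k z≤n))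
           (sum-antisymmetric (λ j k → f (suc j) (suc k)) λ j k j≤k → anti (suc j) (suc k) (s≤s j≤k)) ⟩
    0ℚ ∎
    where
    open ≡-Reasoning
    rest = sum λ j → sum λ k → f (suc j) (suc k)

  -- For j ≤ k the index pairs (`inject₁ j` , k) and (`suc k` , j) delete the same columns j and k +
  -- 1 in opposite orders. This lemma and the next two say so for the second column deleted and for
  -- those that remain.
  punchIn-inject₁ : ∀ {n} {j k : Fin n} → j ≤ k → punchIn (inject₁ j) k ≡ suc k
  punchIn-inject₁ {j = zero}                _         = refl
  punchIn-inject₁ {j = suc j} {k = suc k} (s≤s j≤k) = cong suc (punchIn-inject₁ j≤k)

  punchIn-suc : ∀ {n} {j k : Fin n} → j ≤ k → punchIn (suc k) j ≡ inject₁ j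
  punchIn-suc {j = zero}                _         = refl
  punchIn-suc {j = suc j} {k = suc k} (s≤s j≤k) = cong suc (punchIn-suc j≤k)

  punchIn-punchIn : ∀ {n} {j k : Fin (suc n)} → j ≤ k → ∀ l →
                    punchIn (inject₁ j) (punchIn k l) ≡ punchIn (suc k) (punchIn j l)
  punchIn-punchIn {j = zero}                _         l       = refl
  punchIn-punchIn {j = suc j} {k = suc k} (s≤s j≤k) zero    = refl
  punchIn-punchIn {j = suc j} {k = suc k} (s≤s j≤k) (suc l) = cong suc (punchIn-punchIn j≤k l)

  -- Equal rows below the top one survive in every minor. For the top two rows, expand twice:
  -- deleting two columns in either order leaves the same double minor and, as the rows agree, the
  -- same entries, but opposite signs.
  det-adjacent : ∀ {n} (i j : Fin n) → toℕ j ≡ suc (toℕ i) → {R : Rows n n} → R i ≗ R j → det R ≡ 0ℚ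
  det-adjacent (suc i) (suc j) eq {R} Ri≗Rj = sum-zero λ l →
    trans (cong (sign l * R zero l *_) (det-adjacent i j (ℕ.suc-injective eq) λ k → Ri≗Rj (punchIn l k)))
          (*-zeroʳ (sign l * R zero l))
  det-adjacent {suc (suc n)} zero (suc zero) eq {R} R0≗R1 =
    trans (sum-cong-≗ λ j → *-distribˡ-sum (sign j * R zero j)
            λ k → sign k * R (suc zero) (punchIn j k) * D j k) (sum-antisymmetric f anti)
    where
    open ≡-Reasoning
    D : Fin (suc (suc n)) → Fin (suc n) → ℚ
    D j k = det λ i l → R (suc (suc i)) (punchIn j (punchIn k l))
    f : Fin (suc (suc n)) → Fin (suc n) → ℚ
    f j k = sign j * R zero j * (sign k * R (suc zero) (punchIn j k) * D j k)
    anti : ∀ j k → j ≤ k → f (inject₁ j) k + f (suc k) j ≡ 0ℚ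
    anti j k j≤k = begin
      sign (inject₁ j) * R zero (inject₁ j) * (sign k * R (suc zero) (punchIn (inject₁ j) k) * D (inject₁ j) k)
        + sign (suc k) * R zero (suc k) * (sign j * R (suc zero) (punchIn (suc k) j) * D (suc k) j)
        ≡⟨ cong₂ (λ x y → sign (inject₁ j) * x * (sign k * R (suc zero) (punchIn (inject₁ j) k) * D (inject₁ j) k)
             + sign (suc k) * y * (sign j * R (suc zero) (punchIn (suc k) j) * D (suc k) j)) (R0≗R1 _) (R0≗R1 _) ⟩
      sign (inject₁ j) * R (suc zero) (inject₁ j) * (sign k * R (suc zero) (punchIn (inject₁ j) k) * D (inject₁ j) k)
        + sign (suc k) * R (suc zero) (suc k) * (sign j * R (suc zero) (punchIn (suc k) j) * D (suc k) j)
        ≡⟨ cong₂ (λ x y → sign (inject₁ j) * R (suc zero) (inject₁ j) * (sign k * R (suc zero) x * D (inject₁ j) k)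
             + sign (suc k) * R (suc zero) (suc k) * (sign j * R (suc zero) y * D (suc k) j))
             (punchIn-inject₁ j≤k) (punchIn-suc j≤k) ⟩
      sign (inject₁ j) * R (suc zero) (inject₁ j) * (sign k * R (suc zero) (suc k) * D (inject₁ j) k)
        + sign (suc k) * R (suc zero) (suc k) * (sign j * R (suc zero) (inject₁ j) * D (suc k) j)
        ≡⟨ cong₂ (λ x y → (- 1ℚ) ^ x * R (suc zero) (inject₁ j) * (sign k * R (suc zero) (suc k) * y)
             + sign (suc k) * R (suc zero) (suc k) * (sign j * R (suc zero) (inject₁ j) * D (suc k) j))
             (toℕ-inject₁ j)
             (det-cong λ i l → cong (R (suc (suc i))) (punchIn-punchIn j≤k l)) ⟩
      sign j * R (suc zero) (inject₁ j) * (sign k * R (suc zero) (suc k) * D (suc k) j)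
        + - 1ℚ * sign k * R (suc zero) (suc k) * (sign j * R (suc zero) (inject₁ j) * D (suc k) j)
        ≡⟨ solve 5 (λ s t x y d → s :* x :* (t :* y :* d) :+ con (- 1ℚ) :* t :* y :* (s :* x :* d) := con 0ℚ)
             refl (sign j) (sign k) (R (suc zero) (inject₁ j)) (R (suc zero) (suc k)) (D (suc k) j) ⟩
      0ℚ ∎

  det-alternating : ∀ {n} → Alternating (det {n})
  det-alternating = record { F-cong = det-cong ; linear = det-linear ; adjacent = det-adjacent }

module Spectral where

  open import Algebra.Bundles using (CommutativeRing; Semiring)
  open import Data.Bool.Base using (if_then_else_)
  open import Data.Fin.Base using (Fin; zero; suc; punchIn; punchOut)
  import Data.Fin.Properties as Fin
  import Data.Integer.Base as ℤ
  import Data.Integer.Properties as ℤ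
  open import Data.Rational.Base
  open import Data.Rational.Properties
  open import Data.Rational.Solver using (module +-*-Solver)
  import Data.Rational.Unnormalised.Base as ℚᵘ
  import Data.Rational.Unnormalised.Properties as ℚᵘ
  open import Data.Vec.Functional using (_∷_)
  open import Algebra.Definitions.RawSemiring (Semiring.rawSemiring (CommutativeRing.semiring +-*-commutativeRing)) public
    using (product)
  open Determinant
  open +-*-Solver using (solve; _:=_; _:+_; _:*_; _:-_; :-_; con)

  -- Inequalities between rationals

  *-monoˡ-≤ : ∀ {c a b} → 0ℚ ≤ c → a ≤ b → c * a ≤ c * b
  *-monoˡ-≤ {c} 0≤c = *-monoˡ-≤-nonNeg c {{nonNegative 0≤c}}

  *-mono-≤ : ∀ {a b c d} → 0ℚ ≤ a → a ≤ b → 0ℚ ≤ c → c ≤ d → a * c ≤ b * d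
  *-mono-≤ {a} {b} {c} {d} 0≤a a≤b 0≤c c≤d = begin
    a * c  ≤⟨ *-monoʳ-≤-nonNeg c {{nonNegative 0≤c}} a≤b ⟩
    b * c  ≤⟨ *-monoˡ-≤ (≤-trans 0≤a a≤b) c≤d ⟩
    b * d  ∎
    where open ≤-Reasoning

  0≤* : ∀ {a b} → 0ℚ ≤ a → 0ℚ ≤ b → 0ℚ ≤ a * b
  0≤* {a} {b} 0≤a 0≤b = *-mono-≤ {0ℚ} {a} {0ℚ} {b} ≤-refl 0≤a ≤-refl 0≤b

  0≤+ : ∀ {a b} → 0ℚ ≤ a → 0ℚ ≤ b → 0ℚ ≤ a + b
  0≤+ {a} {b} 0≤a 0≤b = +-mono-≤ 0≤a 0≤b

  0<* : ∀ {a b} → 0ℚ < a → 0ℚ < b → 0ℚ < a * b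
  0<* {a} {b} 0<a 0<b = positive⁻¹ (a * b) {{pos*pos⇒pos a {{positive 0<a}} b {{positive 0<b}}}}

  0≤1 : 0ℚ ≤ 1ℚ
  0≤1 = nonNegative⁻¹ 1ℚ

  0<½ : 0ℚ < ½
  0<½ = positive⁻¹ ½

  p≤∣p∣ : ∀ p → p ≤ ∣ p ∣
  p≤∣p∣ p with ≤-total 0ℚ p
  ... | inj₁ 0≤p = ≤-reflexive (sym (0≤p⇒∣p∣≡p 0≤p))
  ... | inj₂ p≤0 = ≤-trans p≤0 (0≤∣p∣ p)

  p≤q⇒0≤q-p : ∀ {p q} → p ≤ q → 0ℚ ≤ q - p
  p≤q⇒0≤q-p {p} {q} p≤q = ≤-trans (≤-reflexive (sym (+-inverseʳ p))) (+-monoˡ-≤ (- p) p≤q)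

  0≤q-p⇒p≤q : ∀ {p q} → 0ℚ ≤ q - p → p ≤ q
  0≤q-p⇒p≤q {p} {q} 0≤q-p = begin
    p            ≡⟨ +-identityʳ p ⟨
    p + 0ℚ       ≤⟨ +-monoʳ-≤ p 0≤q-p ⟩
    p + (q - p)  ≡⟨ solve 2 (λ p q → p :+ (q :- p) := q) refl p q ⟩
    q            ∎
    where open ≤-Reasoning

  p≤p+q : ∀ p {q} → 0ℚ ≤ q → p ≤ p + q
  p≤p+q p 0≤q = ≤-trans (≤-reflexive (sym (+-identityʳ p))) (+-monoʳ-≤ p 0≤q)

  *-cancelˡ-≤ : ∀ {c a b} → 0ℚ < c → c * a ≤ c * b → a ≤ b
  *-cancelˡ-≤ {c} 0<c = *-cancelˡ-≤-pos c {{positive 0<c}}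

  ∣p∣*∣p∣≡p*p : ∀ p → ∣ p ∣ * ∣ p ∣ ≡ p * p
  ∣p∣*∣p∣≡p*p p with ∣p∣≡p∨∣p∣≡-p p
  ... | inj₁ eq = cong₂ _*_ eq eq
  ... | inj₂ eq = trans (cong₂ _*_ eq eq) (solve 1 (λ p → (:- p) :* (:- p) := p :* p) refl p)

  0≤p*p : ∀ p → 0ℚ ≤ p * p
  0≤p*p p = subst (0ℚ ≤_) (∣p∣*∣p∣≡p*p p) (0≤* (0≤∣p∣ p) (0≤∣p∣ p))

  -- The product is at most the square of the larger factor. The constant is not sharp; it only
  -- feeds crude bounds on quadratic forms.
  ∣p*q∣≤p*p+q*q : ∀ p q → ∣ p * q ∣ ≤ p * p + q * q
  ∣p*q∣≤p*p+q*q p q with ≤-total ∣ p ∣ ∣ q ∣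
  ... | inj₁ p≤q = begin
    ∣ p * q ∣              ≡⟨ ∣p*q∣≡∣p∣*∣q∣ p q ⟩
    ∣ p ∣ * ∣ q ∣          ≤⟨ *-mono-≤ (0≤∣p∣ p) p≤q (0≤∣p∣ q) ≤-refl ⟩
    ∣ q ∣ * ∣ q ∣          ≡⟨ ∣p∣*∣p∣≡p*p q ⟩
    q * q                  ≡⟨ +-identityˡ (q * q) ⟨
    0ℚ + q * q             ≤⟨ +-monoˡ-≤ (q * q) (0≤p*p p) ⟩
    p * p + q * q          ∎
    where open ≤-Reasoning
  ... | inj₂ q≤p = begin
    ∣ p * q ∣              ≡⟨ ∣p*q∣≡∣p∣*∣q∣ p q ⟩
    ∣ p ∣ * ∣ q ∣          ≤⟨ *-mono-≤ (0≤∣p∣ p) ≤-refl (0≤∣p∣ q) q≤p ⟩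
    ∣ p ∣ * ∣ p ∣          ≡⟨ ∣p∣*∣p∣≡p*p p ⟩
    p * p                  ≡⟨ +-identityʳ (p * p) ⟨
    p * p + 0ℚ             ≤⟨ +-monoʳ-≤ (p * p) (0≤p*p q) ⟩
    p * p + q * q          ∎
    where open ≤-Reasoning

  inverse : ∀ {c} → 0ℚ < c → ∃[ r ] (0ℚ < r × r * c ≡ 1ℚ)
  inverse {c} 0<c = 1/ c , positive⁻¹ (1/ c) {{1/pos⇒pos c}} , *-inverseˡ c
    where
    instance
      c-pos : Positive c
      c-pos = positive 0<c
      c-nonZero : NonZero c
      c-nonZero = pos⇒nonZero c

  -- Natural numbers as rationals

  fromNat : ℕ → ℚ
  fromNat n = ℤ.+ n / 1

  toℚᵘ-/ : ∀ i n .{{_ : ℕ.NonZero n}} → toℚᵘ (i / n) ℚᵘ.≃ (i ℚᵘ./ n)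
  toℚᵘ-/ i (suc n) = toℚᵘ-fromℚᵘ (ℚᵘ.mkℚᵘ i n)

  fromNat-+ : ∀ m n → fromNat (m ℕ.+ n) ≡ fromNat m + fromNat n
  fromNat-+ m n = toℚᵘ-injective (begin
    toℚᵘ (fromNat (m ℕ.+ n))                 ≈⟨ toℚᵘ-/ (ℤ.+ (m ℕ.+ n)) 1 ⟩
    ℚᵘ.mkℚᵘ (ℤ.+ (m ℕ.+ n)) 0                ≈⟨ ℚᵘ.*≡* (cong (ℤ._* ℤ.+ 1) (cong₂ ℤ._+_ (sym (ℤ.*-identityʳ (ℤ.+ m))) (sym (ℤ.*-identityʳ (ℤ.+ n))))) ⟩
    ℚᵘ.mkℚᵘ (ℤ.+ m) 0 ℚᵘ.+ ℚᵘ.mkℚᵘ (ℤ.+ n) 0 ≈⟨ ℚᵘ.+-cong (toℚᵘ-/ (ℤ.+ m) 1) (toℚᵘ-/ (ℤ.+ n) 1) ⟨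
    toℚᵘ (fromNat m) ℚᵘ.+ toℚᵘ (fromNat n)   ≈⟨ toℚᵘ-homo-+ (fromNat m) (fromNat n) ⟨
    toℚᵘ (fromNat m + fromNat n)             ∎)
    where open ℚᵘ.≃-Reasoning

  fromNat-* : ∀ m n → fromNat (m ℕ.* n) ≡ fromNat m * fromNat n
  fromNat-* m n = toℚᵘ-injective (begin
    toℚᵘ (fromNat (m ℕ.* n))                 ≈⟨ toℚᵘ-/ (ℤ.+ (m ℕ.* n)) 1 ⟩
    (ℤ.+ (m ℕ.* n)) ℚᵘ./ 1                   ≈⟨ ℚᵘ.*≡* (cong (ℤ._* ℤ.+ 1) (ℤ.pos-* m n)) ⟩
    (ℤ.+ m ℚᵘ./ 1) ℚᵘ.* (ℤ.+ n ℚᵘ./ 1)       ≈⟨ ℚᵘ.*-cong (toℚᵘ-/ (ℤ.+ m) 1) (toℚᵘ-/ (ℤ.+ n) 1) ⟨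
    toℚᵘ (fromNat m) ℚᵘ.* toℚᵘ (fromNat n)   ≈⟨ toℚᵘ-homo-* (fromNat m) (fromNat n) ⟨
    toℚᵘ (fromNat m * fromNat n)             ∎)
    where open ℚᵘ.≃-Reasoning

  fromNat-inverse : ∀ n .{{_ : ℕ.NonZero n}} → fromNat n * (ℤ.+ 1 / n) ≡ 1ℚ
  fromNat-inverse n@(suc n-1) = toℚᵘ-injective (begin
    toℚᵘ (fromNat n * (ℤ.+ 1 / n))           ≈⟨ toℚᵘ-homo-* (fromNat n) (ℤ.+ 1 / n) ⟩
    toℚᵘ (fromNat n) ℚᵘ.* toℚᵘ (ℤ.+ 1 / n)   ≈⟨ ℚᵘ.*-cong (toℚᵘ-/ (ℤ.+ n) 1) (toℚᵘ-/ (ℤ.+ 1) n) ⟩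
    (ℤ.+ n ℚᵘ./ 1) ℚᵘ.* (ℤ.+ 1 ℚᵘ./ n)       ≈⟨ ℚᵘ.*≡* (cong ℤ.+_ (trans (ℕ.*-identityʳ (n ℕ.* 1)) (trans (ℕ.*-comm n 1) (sym (ℕ.*-identityˡ (1 ℕ.* n)))))) ⟩
    ℚᵘ.1ℚᵘ                                   ∎)
    where open ℚᵘ.≃-Reasoning

  0≤fromNat : ∀ n → 0ℚ ≤ fromNat n
  0≤fromNat n = nonNegative⁻¹ (fromNat n) {{normalize-nonNeg n 1}}

  0≤1/ : ∀ n .{{_ : ℕ.NonZero n}} → 0ℚ ≤ ℤ.+ 1 / n
  0≤1/ n = nonNegative⁻¹ (ℤ.+ 1 / n) {{normalize-nonNeg 1 n}}

  fromNat-mono : ∀ {m n} → m ℕ.≤ n → fromNat m ≤ fromNat n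
  fromNat-mono {m} {n} m≤n = begin
    fromNat m                       ≤⟨ p≤p+q (fromNat m) (0≤fromNat (n ℕ.∸ m)) ⟩
    fromNat m + fromNat (n ℕ.∸ m)   ≡⟨ fromNat-+ m (n ℕ.∸ m) ⟨
    fromNat (m ℕ.+ (n ℕ.∸ m))       ≡⟨ cong fromNat (ℕ.m+[n∸m]≡n m≤n) ⟩
    fromNat n                       ∎
    where open ≤-Reasoning

  0≤^ : ∀ {r} n → 0ℚ ≤ r → 0ℚ ≤ r ^ n
  0≤^ zero    0≤r = 0≤1
  0≤^ (suc n) 0≤r = 0≤* 0≤r (0≤^ n 0≤r)

  ^-mono : ∀ {r s} n → 0ℚ ≤ r → r ≤ s → r ^ n ≤ s ^ n
  ^-mono zero    0≤r r≤s = ≤-refl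
  ^-mono (suc n) 0≤r r≤s = *-mono-≤ 0≤r r≤s (0≤^ n 0≤r) (^-mono n 0≤r r≤s)

  archimedean : ∀ p → ∃[ n ] p ≤ fromNat n
  archimedean p@(mkℚ i d-1 _) = ℤ.∣ i ∣ , toℚᵘ-cancel-≤ (ℚᵘ.≤-trans (ℚᵘ.*≤* le)
      (ℚᵘ.≤-reflexive (ℚᵘ.≃-sym (toℚᵘ-/ (ℤ.+ ℤ.∣ i ∣) 1))))
    where
    open ℤ.≤-Reasoning
    i≤∣i∣ : ∀ i → i ℤ.≤ ℤ.+ ℤ.∣ i ∣
    i≤∣i∣ (ℤ.+ n)      = ℤ.≤-refl
    i≤∣i∣ (ℤ.-[1+ n ]) = ℤ.-≤+
    le : i ℤ.* ℤ.+ 1 ℤ.≤ ℤ.+ ℤ.∣ i ∣ ℤ.* ℤ.+ suc d-1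
    le = begin
      i ℤ.* ℤ.+ 1                  ≡⟨ ℤ.*-identityʳ i ⟩
      i                            ≤⟨ i≤∣i∣ i ⟩
      ℤ.+ ℤ.∣ i ∣                  ≤⟨ ℤ.+≤+ (ℕ.m≤m*n ℤ.∣ i ∣ (suc d-1)) ⟩
      ℤ.+ (ℤ.∣ i ∣ ℕ.* suc d-1)    ≡⟨ ℤ.pos-* ℤ.∣ i ∣ (suc d-1) ⟩
      ℤ.+ ℤ.∣ i ∣ ℤ.* ℤ.+ suc d-1  ∎

  -- Finite sums and bounds on determinants

  sum-neg : ∀ {n} (f : Vec n) → sum (λ i → - f i) ≡ - sum f
  sum-neg f = begin
    sum (λ i → - f i)       ≡⟨ sum-cong-≗ (λ i → solve 1 (λ p → :- p := con (- 1ℚ) :* p) refl (f i)) ⟩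
    sum (λ i → - 1ℚ * f i)  ≡⟨ *-distribˡ-sum (- 1ℚ) f ⟨
    - 1ℚ * sum f            ≡⟨ solve 1 (λ p → con (- 1ℚ) :* p := :- p) refl (sum f) ⟩
    - sum f                 ∎
    where open ≡-Reasoning

  sum-mono : ∀ {n} {f g : Vec n} → (∀ i → f i ≤ g i) → sum f ≤ sum g
  sum-mono {zero}  f≤g = ≤-refl
  sum-mono {suc n} f≤g = +-mono-≤ (f≤g zero) (sum-mono (f≤g ∘ suc))

  0≤sum : ∀ {n} {f : Vec n} → (∀ i → 0ℚ ≤ f i) → 0ℚ ≤ sum f
  0≤sum {n} 0≤f = ≤-trans (≤-reflexive (sym (sum-replicate-zero n))) (sum-mono 0≤f)

  ∣sum∣≤sum∣∣ : ∀ {n} (f : Vec n) → ∣ sum f ∣ ≤ sum (∣_∣ ∘ f)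
  ∣sum∣≤sum∣∣ {zero}  f = ≤-refl
  ∣sum∣≤sum∣∣ {suc n} f = ≤-trans (∣p+q∣≤∣p∣+∣q∣ (f zero) (sum (f ∘ suc))) (+-monoʳ-≤ ∣ f zero ∣ (∣sum∣≤sum∣∣ (f ∘ suc)))

  ones : ∀ n → ℚ
  ones n = sum {n} (λ _ → 1ℚ)

  sum-const : ∀ {n} c → sum {n} (λ _ → c) ≡ ones n * c
  sum-const {n} c = trans (sum-cong-≗ {n} λ _ → sym (*-identityˡ c)) (sym (*-distribʳ-sum {n} c (λ _ → 1ℚ)))

  ones≡fromNat : ∀ n → ones n ≡ fromNat n
  ones≡fromNat zero    = refl
  ones≡fromNat (suc n) = trans (cong (1ℚ +_) (ones≡fromNat n)) (sym (fromNat-+ 1 n))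

  vec-bounded : ∀ {n} (f : Vec n) → ∃[ K ] (0ℚ ≤ K × (∀ i → ∣ f i ∣ ≤ K))
  vec-bounded {zero}  f = 0ℚ , ≤-refl , λ ()
  vec-bounded {suc n} f with vec-bounded (f ∘ suc)
  ... | K , 0≤K , f≤K = ∣ f zero ∣ + K , 0≤+ (0≤∣p∣ (f zero)) 0≤K , λ
    { zero    → ≤-trans (≤-reflexive (sym (+-identityʳ _))) (+-monoʳ-≤ ∣ f zero ∣ 0≤K)
    ; (suc i) → ≤-trans (f≤K i) (≤-trans (≤-reflexive (sym (+-identityˡ K))) (+-monoˡ-≤ K (0≤∣p∣ (f zero))))
    }

  bounded : ∀ {k n} (M : Rows k n) → ∃[ K ] (0ℚ ≤ K × (∀ i j → ∣ M i j ∣ ≤ K))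
  bounded M with vec-bounded (λ i → proj₁ (vec-bounded (M i)))
  ... | K , 0≤K , ≤K = K , 0≤K , λ i j →
    let Kᵢ , _ , Mᵢ≤Kᵢ = vec-bounded (M i) in ≤-trans (Mᵢ≤Kᵢ j) (≤-trans (p≤∣p∣ Kᵢ) (≤K i))

  ∣sign∣≡1 : ∀ {n} (j : Fin n) → ∣ sign j ∣ ≡ 1ℚ
  ∣sign∣≡1 zero    = refl
  ∣sign∣≡1 (suc j) = trans (∣p*q∣≡∣p∣*∣q∣ (- 1ℚ) (sign j)) (cong (1ℚ *_) (∣sign∣≡1 j))

  sign*sign≡1 : ∀ {n} (j : Fin n) → sign j * sign j ≡ 1ℚ
  sign*sign≡1 j = trans (sym (∣p∣*∣p∣≡p*p (sign j))) (cong₂ _*_ (∣sign∣≡1 j) (∣sign∣≡1 j))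

  ∣sign*∣ : ∀ {n} (j : Fin n) p → ∣ sign j * p ∣ ≡ ∣ p ∣
  ∣sign*∣ j p = begin
    ∣ sign j * p ∣      ≡⟨ ∣p*q∣≡∣p∣*∣q∣ (sign j) p ⟩
    ∣ sign j ∣ * ∣ p ∣  ≡⟨ cong (λ s → s * ∣ p ∣) (∣sign∣≡1 j) ⟩
    1ℚ * ∣ p ∣          ≡⟨ *-identityˡ ∣ p ∣ ⟩
    ∣ p ∣               ∎
    where open ≡-Reasoning

  -- K is chosen before the matrix. This uniformity is what makes the step of the descent the same
  -- for all t.
  det-bounded : ∀ n E → 0ℚ ≤ E → ∃[ K ] (0ℚ ≤ K ×
                (∀ (M : Rows n n) → (∀ i j → ∣ M i j ∣ ≤ E) → ∣ det M ∣ ≤ K))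
  det-bounded zero    E 0≤E = 1ℚ , 0≤1 , λ _ _ → ≤-refl
  det-bounded (suc n) E 0≤E with det-bounded n E 0≤E
  ... | K , 0≤K , det≤K = sum {suc n} (λ _ → E * K) , 0≤sum {suc n} (λ _ → 0≤* 0≤E 0≤K) , λ M M≤E →
    ≤-trans (∣sum∣≤sum∣∣ (λ j → sign j * M zero j * det (minor M j))) (sum-mono λ j → begin
      ∣ sign j * M zero j * det (minor M j) ∣
        ≡⟨ ∣p*q∣≡∣p∣*∣q∣ (sign j * M zero j) (det (minor M j)) ⟩
      ∣ sign j * M zero j ∣ * ∣ det (minor M j) ∣
        ≡⟨ cong (λ p → p * ∣ det (minor M j) ∣) (∣sign*∣ j (M zero j)) ⟩
      ∣ M zero j ∣ * ∣ det (minor M j) ∣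
        ≤⟨ *-mono-≤ (0≤∣p∣ (M zero j)) (M≤E zero j) (0≤∣p∣ (det (minor M j))) (det≤K (minor M j) λ i k → M≤E (suc i) (punchIn j k)) ⟩
      E * K ∎)
    where open ≤-Reasoning

  -- Quadratic forms

  dot : ∀ {n} → Vec n → Vec n → ℚ
  dot x y = sum λ i → x i * y i

  infixr 8 _·_
  _·_ : ∀ {k n} → Rows k n → Vec n → Vec k
  (M · y) i = dot (M i) y

  norm² : ∀ {n} → Vec n → ℚ
  norm² x = dot x x

  I : ∀ {n} → Rows n n
  I i j = if does (i Fin.≟ j) then 1ℚ else 0ℚ

  I-diagonal : ∀ {n} (i : Fin n) → I i i ≡ 1ℚ
  I-diagonal i = cong (if_then 1ℚ else 0ℚ) (dec-true (i Fin.≟ i) refl)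

  I-off-diagonal : ∀ {n} {i j : Fin n} → i ≢ j → I i j ≡ 0ℚ
  I-off-diagonal {i = i} {j} i≢j = cong (if_then 1ℚ else 0ℚ) (dec-false (i Fin.≟ j) i≢j)

  ∣I∣≤1 : ∀ {n} (i j : Fin n) → ∣ I i j ∣ ≤ 1ℚ
  ∣I∣≤1 i j with i Fin.≟ j
  ... | yes _ = ≤-refl
  ... | no  _ = 0≤1

  sum-single : ∀ {n} (f : Vec n) i → (∀ j → j ≢ i → f j ≡ 0ℚ) → sum f ≡ f i
  sum-single {suc n} f i f≡0 = begin
    sum f                          ≡⟨ sum-remove {i = i} f ⟩
    f i + sum (f ∘ punchIn i)      ≡⟨ cong (f i +_) (sum-zero λ k → f≡0 (punchIn i k) (Fin.punchInᵢ≢i i k)) ⟩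
    f i + 0ℚ                       ≡⟨ +-identityʳ (f i) ⟩
    f i                            ∎
    where open ≡-Reasoning

  sum-*-I : ∀ {n} (v : Vec n) j → sum (λ k → v k * I k j) ≡ v j
  sum-*-I v j = begin
    sum (λ k → v k * I k j)  ≡⟨ sum-single (λ k → v k * I k j) j (λ k k≢j → trans (cong (v k *_) (I-off-diagonal k≢j)) (*-zeroʳ (v k))) ⟩
    v j * I j j              ≡⟨ cong (v j *_) (I-diagonal j) ⟩
    v j * 1ℚ                 ≡⟨ *-identityʳ (v j) ⟩
    v j                      ∎
    where open ≡-Reasoning

  I-· : ∀ {n} (x : Vec n) i → (I · x) i ≡ x i
  I-· x i = begin
    sum (λ k → I i k * x k)  ≡⟨ sum-single (λ k → I i k * x k) i (λ k k≢i → trans (cong (_* x k) (I-off-diagonal (k≢i ∘ sym))) (*-zeroˡ (x k))) ⟩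
    I i i * x i              ≡⟨ cong (_* x i) (I-diagonal i) ⟩
    1ℚ * x i                 ≡⟨ *-identityˡ (x i) ⟩
    x i                      ∎
    where open ≡-Reasoning

  dot-comm : ∀ {n} (x y : Vec n) → dot x y ≡ dot y x
  dot-comm x y = sum-cong-≗ λ i → *-comm (x i) (y i)

  dot-congʳ : ∀ {n} (x : Vec n) {y z : Vec n} → y ≗ z → dot x y ≡ dot x z
  dot-congʳ x y≗z = sum-cong-≗ λ i → cong (x i *_) (y≗z i)

  dot-axpyʳ : ∀ {n} (x : Vec n) a y z → dot x (axpy a y z) ≡ a * dot x y + dot x z
  dot-axpyʳ x a y z = sum-linear a λ i →
    solve 4 (λ x a y z → x :* (a :* y :+ z) := a :* (x :* y) :+ x :* z) refl (x i) a (y i) (z i)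

  dot-axpyˡ : ∀ {n} (x : Vec n) a y z → dot (axpy a y z) x ≡ a * dot y x + dot z x
  dot-axpyˡ x a y z = sum-linear a λ i →
    solve 4 (λ x a y z → (a :* y :+ z) :* x := a :* (y :* x) :+ z :* x) refl (x i) a (y i) (z i)

  dot-scaleʳ : ∀ {n} (x : Vec n) a y → dot x (λ i → a * y i) ≡ a * dot x y
  dot-scaleʳ x a y = trans (sum-cong-≗ λ i → solve 3 (λ x a y → x :* (a :* y) := a :* (x :* y)) refl (x i) a (y i))
                           (sym (*-distribˡ-sum a (λ i → x i * y i)))

  Symmetric : ∀ {n} → Rows n n → Set
  Symmetric M = ∀ i j → M i j ≡ M j i

  dot-symmetric : ∀ {n} {M : Rows n n} → Symmetric M → ∀ x y → dot x (M · y) ≡ dot y (M · x)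
  dot-symmetric {M = M} sym-M x y = begin
    sum (λ i → x i * sum (λ j → M i j * y j))    ≡⟨ sum-cong-≗ (λ i → *-distribˡ-sum (x i) (λ j → M i j * y j)) ⟩
    sum (λ i → sum (λ j → x i * (M i j * y j)))  ≡⟨ ∑-comm (λ i j → x i * (M i j * y j)) ⟩
    sum (λ j → sum (λ i → x i * (M i j * y j)))  ≡⟨ sum-cong-≗ (λ j → sum-cong-≗ λ i → exchange i j) ⟩
    sum (λ j → sum (λ i → y j * (M j i * x i)))  ≡⟨ sum-cong-≗ (λ j → *-distribˡ-sum (y j) (λ i → M j i * x i)) ⟨
    sum (λ j → y j * sum (λ i → M j i * x i))    ∎
    where
    open ≡-Reasoning
    exchange : ∀ i j → x i * (M i j * y j) ≡ y j * (M j i * x i)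
    exchange i j = trans (cong (λ m → x i * (m * y j)) (sym-M i j))
      (solve 3 (λ x m y → x :* (m :* y) := y :* (m :* x)) refl (x i) (M j i) (y j))

  0≤norm² : ∀ {n} (x : Vec n) → 0ℚ ≤ norm² x
  0≤norm² x = 0≤sum λ i → 0≤p*p (x i)

  -- Each term is at most K (xᵢ² + yⱼ²), and in the double sum every square occurs n times.
  ∣dot∣-bounded : ∀ {n} (M : Rows n n) {K} → 0ℚ ≤ K → (∀ i j → ∣ M i j ∣ ≤ K) →
                ∀ x y → ∣ dot x (M · y) ∣ ≤ ones n * K * (norm² x + norm² y)
  ∣dot∣-bounded {n} M {K} 0≤K M≤K x y = begin
    ∣ dot x (M · y) ∣
      ≤⟨ ∣sum∣≤sum∣∣ (λ i → x i * (M · y) i) ⟩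
    sum (λ i → ∣ x i * (M · y) i ∣)
      ≤⟨ sum-mono (λ i → ≤-trans (≤-reflexive (cong ∣_∣ (*-distribˡ-sum (x i) (λ j → M i j * y j))))
           (≤-trans (∣sum∣≤sum∣∣ (λ j → x i * (M i j * y j))) (sum-mono (entry i)))) ⟩
    sum (λ i → sum (λ j → K * (x i * x i) + K * (y j * y j)))
      ≡⟨ sum-cong-≗ (λ i → trans (∑-distrib-+ (λ _ → K * (x i * x i)) (λ j → K * (y j * y j)))
           (cong₂ _+_ (sum-const {n} (K * (x i * x i))) (sym (*-distribˡ-sum K (λ j → y j * y j))))) ⟩
    sum (λ i → ones n * (K * (x i * x i)) + K * norm² y)
      ≡⟨ ∑-distrib-+ (λ i → ones n * (K * (x i * x i))) (λ _ → K * norm² y) ⟩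
    sum (λ i → ones n * (K * (x i * x i))) + sum {n} (λ _ → K * norm² y)
      ≡⟨ cong₂ _+_ (trans (sym (*-distribˡ-sum (ones n) (λ i → K * (x i * x i))))
                          (cong (ones n *_) (sym (*-distribˡ-sum K (λ i → x i * x i)))))
                   (sum-const {n} (K * norm² y)) ⟩
    ones n * (K * norm² x) + ones n * (K * norm² y)
      ≡⟨ solve 4 (λ o k a b → o :* (k :* a) :+ o :* (k :* b) := o :* k :* (a :+ b)) refl (ones n) K (norm² x) (norm² y) ⟩
    ones n * K * (norm² x + norm² y) ∎
    where
    open ≤-Reasoning
    entry : ∀ i j → ∣ x i * (M i j * y j) ∣ ≤ K * (x i * x i) + K * (y j * y j)
    entry i j = begin
      ∣ x i * (M i j * y j) ∣
        ≡⟨ cong ∣_∣ (solve 3 (λ x m y → x :* (m :* y) := m :* (x :* y)) refl (x i) (M i j) (y j)) ⟩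
      ∣ M i j * (x i * y j) ∣
        ≡⟨ ∣p*q∣≡∣p∣*∣q∣ (M i j) (x i * y j) ⟩
      ∣ M i j ∣ * ∣ x i * y j ∣
        ≤⟨ *-mono-≤ (0≤∣p∣ (M i j)) (M≤K i j) (0≤∣p∣ (x i * y j)) (∣p*q∣≤p*p+q*q (x i) (y j)) ⟩
      K * (x i * x i + y j * y j)
        ≡⟨ *-distribˡ-+ K (x i * x i) (y j * y j) ⟩
      K * (x i * x i) + K * (y j * y j) ∎

  -- Cramer's rule and coercivity

  module _ {n} (S : Rows (suc n) (suc n)) where

    -- Up to the factor (-1)ʲ, the entry (k , j) of the adjugate of S: the unit row k is put on top
    -- instead of in place of row j. The missing sign is attached to the vector that the matrix is
    -- applied to.
    cofactor : Rows (suc n) (suc n)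
    cofactor k j = det (I k ∷ (S ∘ punchIn j))

    -- Row i of S against column j of the cofactors is, by linearity in the top row, the determinant
    -- with row i on top and row j removed. For j ≠ i a row is repeated; for j = i moving the row
    -- back costs a sign, which cancels that of x.
    cramer : ∀ (x : Vec (suc n)) i → (S · (cofactor · (λ j → sign j * x j))) i ≡ det S * x i
    cramer x i = begin
      sum (λ k → S i k * sum (λ j → cofactor k j * c j))
        ≡⟨ sum-cong-≗ (λ k → *-distribˡ-sum (S i k) (λ j → cofactor k j * c j)) ⟩
      sum (λ k → sum (λ j → S i k * (cofactor k j * c j)))
        ≡⟨ ∑-comm (λ k j → S i k * (cofactor k j * c j)) ⟩
      sum (λ j → sum (λ k → S i k * (cofactor k j * c j)))
        ≡⟨ sum-cong-≗ (λ j → trans (sum-cong-≗ λ k → sym (*-assoc (S i k) (cofactor k j) (c j)))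
                                   (sym (*-distribʳ-sum (c j) (λ k → S i k * cofactor k j)))) ⟩
      sum (λ j → sum (λ k → S i k * cofactor k j) * c j)
        ≡⟨ sum-cong-≗ (λ j → cong (λ d → d * c j) (expansion j)) ⟩
      sum (λ j → det (S i ∷ (S ∘ punchIn j)) * c j)
        ≡⟨ sum-single (λ j → det (S i ∷ (S ∘ punchIn j)) * c j) i (λ j j≢i → trans (cong (λ d → d * c j) (off-diagonal j j≢i)) (*-zeroˡ (c j))) ⟩
      det (S i ∷ (S ∘ punchIn i)) * c i
        ≡⟨ cong (λ d → d * c i) (move-to-front det-alternating S i) ⟩
      sign i * det S * (sign i * x i)
        ≡⟨ solve 3 (λ s d x → s :* d :* (s :* x) := s :* s :* (d :* x)) refl (sign i) (det S) (x i) ⟩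
      sign i * sign i * (det S * x i)
        ≡⟨ cong (λ s → s * (det S * x i)) (sign*sign≡1 i) ⟩
      1ℚ * (det S * x i)
        ≡⟨ *-identityˡ (det S * x i) ⟩
      det S * x i ∎
      where
      open ≡-Reasoning
      c : Vec (suc n)
      c j = sign j * x j
      expansion : ∀ j → sum (λ k → S i k * cofactor k j) ≡ det (S i ∷ (S ∘ punchIn j))
      expansion j = trans (sym (sum-head det-alternating (S i) I (S ∘ punchIn j)))
        (det-cong (∷-cong {R = S ∘ punchIn j} (sum-*-I (S i)) (λ _ _ → refl)))
      off-diagonal : ∀ j → j ≢ i → det (S i ∷ (S ∘ punchIn j)) ≡ 0ℚ
      off-diagonal j j≢i = repeated det-alternating (S i) (S ∘ punchIn j) (punchOut j≢i)
        λ k → cong (λ l → S l k) (sym (Fin.punchIn-punchOut j≢i))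

    norm²-sign : ∀ (x : Vec (suc n)) → norm² (λ j → sign j * x j) ≡ norm² x
    norm²-sign x = sum-cong-≗ λ j → begin
      sign j * x j * (sign j * x j)   ≡⟨ solve 2 (λ s x → s :* x :* (s :* x) := s :* s :* (x :* x)) refl (sign j) (x j) ⟩
      sign j * sign j * (x j * x j)   ≡⟨ cong (λ s → s * (x j * x j)) (sign*sign≡1 j) ⟩
      1ℚ * (x j * x j)                ≡⟨ *-identityˡ (x j * x j) ⟩
      x j * x j                       ∎
      where open ≡-Reasoning

    -- Evaluate the form at y − C x, where S y = (det S) x.
    coercive : Symmetric S → (∀ x → 0ℚ ≤ dot x (S · x)) →
               ∀ {K C c} → 0ℚ ≤ K → (∀ k j → ∣ cofactor k j ∣ ≤ K) →
               0ℚ < C → ones (suc n) * K * (1ℚ + 1ℚ) ≤ C → 0ℚ ≤ c → c ≤ det S →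
               ∀ x → c * norm² x ≤ C * dot x (S · x)
    coercive sym-S psd {K} {C} {c} 0≤K cofactor≤K 0<C K≤C 0≤c c≤D x = begin
      c * N    ≤⟨ *-mono-≤ 0≤c c≤D (0≤norm² x) ≤-refl ⟩
      D * N    ≤⟨ 0≤q-p⇒p≤q (*-cancelˡ-≤ 0<C (≤-trans (≤-reflexive (*-zeroʳ C)) (≤-trans (psd z) form-z≤))) ⟩
      C * Q    ∎
      where
      open ≤-Reasoning
      D = det S
      N = norm² x
      Q = dot x (S · x)
      x± : Vec (suc n)
      x± j = sign j * x j
      y = cofactor · x±
      z = axpy (- C) x y
      xy≤ : dot x y ≤ C * N
      xy≤ = begin
        dot x y                                      ≤⟨ p≤∣p∣ (dot x y) ⟩
        ∣ dot x y ∣                                  ≤⟨ ∣dot∣-bounded cofactor 0≤K cofactor≤K x x± ⟩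
        ones (suc n) * K * (N + norm² x±)            ≡⟨ cong (λ r → ones (suc n) * K * (N + r)) (norm²-sign x) ⟩
        ones (suc n) * K * (N + N)                   ≡⟨ solve 2 (λ k a → k :* (a :+ a) := k :* (con 1ℚ :+ con 1ℚ) :* a) refl (ones (suc n) * K) N ⟩
        ones (suc n) * K * (1ℚ + 1ℚ) * N             ≤⟨ *-monoʳ-≤-nonNeg N {{nonNegative (0≤norm² x)}} K≤C ⟩
        C * N                                        ∎
      x·Sy : dot x (S · y) ≡ D * N
      x·Sy = trans (dot-congʳ x (cramer x)) (dot-scaleʳ x D x)
      y·Sy : dot y (S · y) ≡ D * dot x y
      y·Sy = trans (dot-congʳ y (cramer x)) (trans (dot-scaleʳ y D x) (cong (D *_) (dot-comm y x)))
      form-z : dot z (S · z) ≡ - C * (- C * Q + dot y (S · x)) + (- C * dot x (S · y) + dot y (S · y))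
      form-z = trans (dot-congʳ z {S · z} {axpy (- C) (S · x) (S · y)} (λ i → dot-axpyʳ (S i) (- C) x y))
        (trans (dot-axpyʳ z (- C) (S · x) (S · y))
          (cong₂ (λ p q → - C * p + q) (dot-axpyˡ (S · x) (- C) x y) (dot-axpyˡ (S · y) (- C) x y)))
      -- The form at z equals C²Q - 2CDN + D (x · y). Bounding x · y by CN absorbs one of the two
      -- copies of CDN and leaves a multiple of the desired difference.
      form-z≤ : dot z (S · z) ≤ C * (C * Q - D * N)
      form-z≤ = begin
        dot z (S · z)
          ≡⟨ form-z ⟩
        - C * (- C * Q + dot y (S · x)) + (- C * dot x (S · y) + dot y (S · y))
          ≡⟨ cong₂ (λ p q → - C * (- C * Q + p) + (- C * dot x (S · y) + q))
               (trans (dot-symmetric sym-S y x) x·Sy) y·Sy ⟩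
        - C * (- C * Q + D * N) + (- C * dot x (S · y) + D * dot x y)
          ≡⟨ cong (λ p → - C * (- C * Q + D * N) + (- C * p + D * dot x y)) x·Sy ⟩
        - C * (- C * Q + D * N) + (- C * (D * N) + D * dot x y)
          ≤⟨ +-monoʳ-≤ (- C * (- C * Q + D * N)) (+-monoʳ-≤ (- C * (D * N)) (*-monoˡ-≤ (≤-trans 0≤c c≤D) xy≤)) ⟩
        - C * (- C * Q + D * N) + (- C * (D * N) + D * (C * N))
          ≡⟨ solve 4 (λ C Q D N → :- C :* (:- C :* Q :+ D :* N) :+ (:- C :* (D :* N) :+ D :* (C :* N))
                                    := C :* (C :* Q :- D :* N)) refl C Q D N ⟩
        C * (C * Q - D * N) ∎

  infixl 6 _·I-_
  _·I-_ : ∀ {n} → ℚ → Rows n n → Rows n n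
  (t ·I- M) i j = t * I i j - M i j

  dot-negˡ : ∀ {n} (v x : Vec n) → dot (λ j → - v j) x ≡ - dot v x
  dot-negˡ v x = begin
    sum (λ j → - v j * x j)            ≡⟨ sum-cong-≗ (λ j → solve 2 (λ v x → :- v :* x := con (- 1ℚ) :* (v :* x)) refl (v j) (x j)) ⟩
    sum (λ j → - 1ℚ * (v j * x j))     ≡⟨ *-distribˡ-sum (- 1ℚ) (λ j → v j * x j) ⟨
    - 1ℚ * dot v x                     ≡⟨ solve 1 (λ p → con (- 1ℚ) :* p := :- p) refl (dot v x) ⟩
    - dot v x                          ∎
    where open ≡-Reasoning

  dot-shift : ∀ {n} t (M : Rows n n) x → dot x ((t ·I- M) · x) ≡ t * norm² x - dot x (M · x)
  dot-shift t M x = begin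
    dot x ((t ·I- M) · x)
      ≡⟨ dot-congʳ x (λ i → dot-axpyˡ x t (I i) (λ j → - M i j)) ⟩
    dot x (axpy t (I · x) (λ i → dot (λ j → - M i j) x))
      ≡⟨ dot-axpyʳ x t (I · x) (λ i → dot (λ j → - M i j) x) ⟩
    t * dot x (I · x) + dot x (λ i → dot (λ j → - M i j) x)
      ≡⟨ cong₂ (λ p q → t * p + q) (dot-congʳ x (I-· x)) (dot-congʳ x (λ i → dot-negˡ (M i) x)) ⟩
    t * norm² x + dot x (λ i → - (M · x) i)
      ≡⟨ cong (t * norm² x +_) (trans (dot-comm x (λ i → - (M · x) i))
           (trans (dot-negˡ (M · x) x) (cong -_ (dot-comm (M · x) x)))) ⟩
    t * norm² x - dot x (M · x) ∎
    where open ≡-Reasoning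

  ·I-symmetric : ∀ {n} t {M : Rows n n} → Symmetric M → Symmetric (t ·I- M)
  ·I-symmetric t sym-M i j = cong₂ (λ p q → t * p - q) (I-symmetric i j) (sym-M i j)
    where
    I-symmetric : ∀ {n} → Symmetric (I {n})
    I-symmetric i j with i Fin.≟ j
    ... | yes refl = sym (I-diagonal i)
    ... | no  i≢j  = sym (I-off-diagonal (i≢j ∘ sym))

  ∣·I-∣≤ : ∀ {n} {t T K} {M : Rows n n} → ∣ t ∣ ≤ T → (∀ i j → ∣ M i j ∣ ≤ K) →
          ∀ i j → ∣ (t ·I- M) i j ∣ ≤ T + K
  ∣·I-∣≤ {t = t} {T} {K} {M} t≤T M≤K i j = begin
    ∣ t * I i j - M i j ∣           ≤⟨ ∣p-q∣≤∣p∣+∣q∣ (t * I i j) (M i j) ⟩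
    ∣ t * I i j ∣ + ∣ M i j ∣       ≡⟨ cong (λ p → p + ∣ M i j ∣) (∣p*q∣≡∣p∣*∣q∣ t (I i j)) ⟩
    ∣ t ∣ * ∣ I i j ∣ + ∣ M i j ∣   ≤⟨ +-mono-≤ (*-mono-≤ (0≤∣p∣ t) t≤T (0≤∣p∣ (I i j)) (∣I∣≤1 i j)) (M≤K i j) ⟩
    T * 1ℚ + K                      ≡⟨ cong (_+ K) (*-identityʳ T) ⟩
    T + K                           ∎
    where open ≤-Reasoning

  -- Descending along t I - M

  infix 4 _≼_
  -- The Loewner order M ≼ t I; for symmetric M it says that no eigenvalue exceeds t.
  _≼_ : ∀ {n} → Rows n n → ℚ → Set
  M ≼ t = ∀ x → dot x (M · x) ≤ t * norm² x

  ≼-mono : ∀ {n} {M : Rows n n} {s t} → s ≤ t → M ≼ s → M ≼ t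
  ≼-mono s≤t M≼s x = ≤-trans (M≼s x) (*-monoʳ-≤-nonNeg (norm² x) {{nonNegative (0≤norm² x)}} s≤t)

  2ℚ : ℚ
  2ℚ = 1ℚ + 1ℚ

  ≼-bounded : ∀ {n} (M : Rows n n) → ∃[ T ] (0ℚ ≤ T × M ≼ T)
  ≼-bounded {n} M with bounded M
  ... | K , 0≤K , M≤K = ones n * K * 2ℚ , 0≤* (0≤* (0≤sum {n} (λ _ → 0≤1)) 0≤K) (0≤+ 0≤1 0≤1) , λ x → begin
    dot x (M · x)                       ≤⟨ p≤∣p∣ (dot x (M · x)) ⟩
    ∣ dot x (M · x) ∣                   ≤⟨ ∣dot∣-bounded M 0≤K M≤K x x ⟩
    ones n * K * (norm² x + norm² x)    ≡⟨ solve 2 (λ k a → k :* (a :+ a) := k :* (con 1ℚ :+ con 1ℚ) :* a) refl (ones n * K) (norm² x) ⟩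
    ones n * K * 2ℚ * norm² x           ∎
    where open ≤-Reasoning

  -- Walk from T down to L in steps of size at most η; of the two points t + η/2 and t + η
  -- above t at least one differs from the exceptional point e.
  descent : (P : ℚ → Set) → (∀ {s t} → s ≤ t → P s → P t) → ∀ {L T η} e → 0ℚ < η → P T →
            (∀ u → L ≤ u → u ≤ T + η → u ≢ e → P u → P (u - η)) → P L
  descent P mono {L} {T} {η} e 0<η P-T step = descend (proj₁ steps) L ≤-refl (proj₂ steps)
    where
    open ≤-Reasoning
    h : ℚ
    h = ½ * η

    0<h : 0ℚ < h
    0<h = 0<* 0<½ 0<η

    h+h≡η : h + h ≡ η
    h+h≡η = trans (sym (*-distribʳ-+ η ½ ½)) (*-identityˡ η)

    h<η : h < η
    h<η = begin-strict
      h        ≡⟨ +-identityʳ h ⟨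
      h + 0ℚ   <⟨ +-monoʳ-< h 0<h ⟩
      h + h    ≡⟨ h+h≡η ⟩
      η        ∎

    -- Every move covers at least the half-step h, so counting half-steps bounds the number of
    -- moves.
    steps : ∃[ k ] T ≤ L + fromNat k * h
    steps = k , (begin
      T                        ≡⟨ solve 2 (λ T L → T := L :+ (T :- L) :* con 1ℚ) refl T L ⟩
      L + (T - L) * 1ℚ         ≡⟨ cong (λ p → L + (T - L) * p) (proj₂ (proj₂ (inverse 0<h))) ⟨
      L + (T - L) * (r * h)    ≡⟨ cong (L +_) (*-assoc (T - L) r h) ⟨
      L + (T - L) * r * h      ≤⟨ +-monoʳ-≤ L (*-monoʳ-≤-nonNeg h {{nonNegative (<⇒≤ 0<h)}} (proj₂ (archimedean ((T - L) * r)))) ⟩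
      L + fromNat k * h        ∎)
      where
      r = proj₁ (inverse 0<h)
      k = proj₁ (archimedean ((T - L) * r))

    at : ∀ t u → L ≤ t → t < T → t ≤ u → u ≤ t + η → u ≢ e → P u → P t
    at t u L≤t t<T t≤u u≤t+η u≢e P-u = mono u-η≤t
      (step u (≤-trans L≤t t≤u) (≤-trans u≤t+η (+-monoˡ-≤ η (<⇒≤ t<T))) u≢e P-u)
      where
      u-η≤t = begin
        u - η      ≤⟨ +-monoˡ-≤ (- η) u≤t+η ⟩
        t + η - η  ≡⟨ solve 2 (λ t η → t :+ η :- η := t) refl t η ⟩
        t          ∎

    next : ∀ k t g → h ≤ g → T ≤ t + fromNat (suc k) * h → T ≤ t + g + fromNat k * h
    next k t g h≤g T≤ = begin
      T                             ≤⟨ T≤ ⟩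
      t + fromNat (suc k) * h       ≡⟨ cong (λ p → t + p * h) (fromNat-+ 1 k) ⟩
      t + (1ℚ + fromNat k) * h      ≡⟨ solve 3 (λ t k h → t :+ (con 1ℚ :+ k) :* h := t :+ h :+ k :* h) refl t (fromNat k) h ⟩
      t + h + fromNat k * h         ≤⟨ +-monoˡ-≤ (fromNat k * h) (+-monoʳ-≤ t h≤g) ⟩
      t + g + fromNat k * h         ∎

    -- The recursion climbs from t towards T, with k half-steps bounding the distance left; `P` is
    -- carried down as the calls return.
    descend : ∀ k t → L ≤ t → T ≤ t + fromNat k * h → P t
    via : ∀ k t g → L ≤ t → t < T → h ≤ g → g ≤ η → T ≤ t + fromNat (suc k) * h → t + g ≢ e → P t

    descend zero t L≤t T≤t = mono (≤-trans T≤t (≤-reflexive (trans (cong (t +_) (*-zeroˡ h)) (+-identityʳ t)))) P-T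
    descend (suc k) t L≤t T≤ = case (t <? T) of λ
      { (no  t≮T) → mono (≮⇒≥ t≮T) P-T
      ; (yes t<T) → case ((t + h) ≟ e) of λ
        { (no  t+h≢e) → via k t h L≤t t<T ≤-refl (<⇒≤ h<η) T≤ t+h≢e
        ; (yes t+h≡e) → via k t η L≤t t<T (<⇒≤ h<η) ≤-refl T≤ λ t+η≡e →
            <⇒≢ (+-monoʳ-< t h<η) (trans t+h≡e (sym t+η≡e))
        }
      }

    via k t g L≤t t<T h≤g g≤η T≤ t+g≢e =
      at t (t + g) L≤t t<T t≤t+g (+-monoʳ-≤ t g≤η) t+g≢e
         (descend k (t + g) (≤-trans L≤t t≤t+g) (next k t g h≤g T≤))
      where t≤t+g = p≤p+q t (≤-trans (<⇒≤ 0<h) h≤g)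

  module _ {n} {M : Rows (suc n) (suc n)} (sym-M : Symmetric M) {L c} (0≤L : 0ℚ ≤ L) (0<c : 0ℚ < c) where

    -- With N = |x|² and q = x · Mx, coercivity reads cN ≤ C (uN - q). Dividing by C gives q ≤ (u -
    -- c/C) N, so η = c/C, where C depends on T but not on u.
    ≼-step : ∀ T → 0ℚ ≤ T → ∃[ η ] (0ℚ < η × η ≤ 1ℚ ×
             (∀ u → L ≤ u → u ≤ T → c ≤ det (u ·I- M) → M ≼ u → M ≼ u - η))
    ≼-step T 0≤T with bounded M
    -- The bound 1 + (T + B) covers both the unit row of a cofactor and the rows of u I - M, for all
    -- u in [L , T] at once.
    ... | B , 0≤B , M≤B with det-bounded (suc n) (1ℚ + (T + B)) (0≤+ 0≤1 (0≤+ 0≤T 0≤B))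
    ... | K , 0≤K , det≤K = η , 0<* 0<r 0<c , η≤1 , step
      where
      open ≤-Reasoning
      C₀ C r η : ℚ
      C₀ = ones (suc n) * K * 2ℚ
      -- The summand c makes C positive even if C₀ is 0, and keeps c/C at most 1.
      C = C₀ + c

      0≤C₀ : 0ℚ ≤ C₀
      0≤C₀ = 0≤* (0≤* (0≤sum {suc n} (λ _ → 0≤1)) 0≤K) (0≤+ 0≤1 0≤1)

      0<C : 0ℚ < C
      0<C = +-mono-≤-< 0≤C₀ 0<c

      r = proj₁ (inverse 0<C)
      η = r * c

      0<r : 0ℚ < r
      0<r = proj₁ (proj₂ (inverse 0<C))

      rC≡1 : r * C ≡ 1ℚ
      rC≡1 = proj₂ (proj₂ (inverse 0<C))

      η≤1 : η ≤ 1ℚ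
      η≤1 = begin
        r * c         ≡⟨ cong (r *_) (+-identityˡ c) ⟨
        r * (0ℚ + c)  ≤⟨ *-monoˡ-≤ (<⇒≤ 0<r) (+-monoˡ-≤ c 0≤C₀) ⟩
        r * C         ≡⟨ rC≡1 ⟩
        1ℚ            ∎

      step : ∀ u → L ≤ u → u ≤ T → c ≤ det (u ·I- M) → M ≼ u → M ≼ u - η
      step u L≤u u≤T c≤D M≼u x = 0≤q-p⇒p≤q (begin
        0ℚ
          ≤⟨ p≤q⇒0≤q-p (*-monoˡ-≤ (<⇒≤ 0<r) cN≤CQ) ⟩
        r * (C * (u * N - q)) - r * (c * N)
          ≡⟨ cong (_- r * (c * N)) (*-assoc r C (u * N - q)) ⟨
        r * C * (u * N - q) - r * (c * N)
          ≡⟨ cong (λ p → p * (u * N - q) - r * (c * N)) rC≡1 ⟩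
        1ℚ * (u * N - q) - r * (c * N)
          ≡⟨ solve 5 (λ u N q r c → con 1ℚ :* (u :* N :- q) :- r :* (c :* N) := (u :- r :* c) :* N :- q)
               refl u N q r c ⟩
        (u - η) * N - q ∎)
        where
        S = u ·I- M
        N = norm² x
        q = dot x (M · x)

        rows≤E : ∀ k j i l → ∣ (I k ∷ (S ∘ punchIn j)) i l ∣ ≤ 1ℚ + (T + B)
        rows≤E k j zero    l = ≤-trans (∣I∣≤1 k l) (p≤p+q 1ℚ (0≤+ 0≤T 0≤B))
        rows≤E k j (suc i) l = begin
          ∣ S (punchIn j i) l ∣   ≤⟨ ∣·I-∣≤ {M = M} (≤-trans (≤-reflexive (0≤p⇒∣p∣≡p (≤-trans 0≤L L≤u))) u≤T) M≤B (punchIn j i) l ⟩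
          T + B                   ≡⟨ +-identityˡ (T + B) ⟨
          0ℚ + (T + B)            ≤⟨ +-monoˡ-≤ (T + B) 0≤1 ⟩
          1ℚ + (T + B)            ∎

        psd : ∀ y → 0ℚ ≤ dot y (S · y)
        psd y = ≤-trans (p≤q⇒0≤q-p (M≼u y)) (≤-reflexive (sym (dot-shift u M y)))

        cN≤CQ : c * N ≤ C * (u * N - q)
        cN≤CQ = subst (λ p → c * N ≤ C * p) (dot-shift u M x)
          (coercive S (·I-symmetric u sym-M) psd 0≤K (λ k j → det≤K (I k ∷ (S ∘ punchIn j)) (rows≤E k j)) 0<C
             (p≤p+q C₀ (<⇒≤ 0<c)) (<⇒≤ 0<c) c≤D x)

    det-positive⇒≼ : ∀ e → (∀ u → L ≤ u → u ≢ e → c ≤ det (u ·I- M)) → M ≼ L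
    det-positive⇒≼ e c≤det =
      let T , 0≤T , M≼T = ≼-bounded M
          -- The descent visits points up to T + η, but η itself depends on the range allowed. As η
          -- ≤ 1, the range up to T + 1 is enough.
          η , 0<η , η≤1 , step = ≼-step (T + 1ℚ) (0≤+ 0≤T 0≤1)
      in descent (M ≼_) (≼-mono {M = M}) {T = T} {η} e 0<η M≼T λ u L≤u u≤T+η u≢e →
           step u L≤u (≤-trans u≤T+η (+-monoʳ-≤ T η≤1)) (c≤det u L≤u u≢e)

  -- Deflation

  module _ {n} {M : Rows (suc n) (suc n)} (sym-M : Symmetric M) {s} (row-sum : ∀ i → sum (M i) ≡ s) where

    column-sum : ∀ t j → sum (λ i → (t ·I- M) i j) ≡ t - s
    column-sum t j = begin
      sum (λ i → t * I i j - M i j)              ≡⟨ ∑-distrib-+ (λ i → t * I i j) (λ i → - M i j) ⟩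
      sum (λ i → t * I i j) + sum (λ i → - M i j) ≡⟨ cong₂ _+_ (sum-*-I (λ _ → t) j) (sum-neg (λ i → M i j)) ⟩
      t - sum (λ i → M i j)                      ≡⟨ cong (λ p → t - p) (trans (sum-cong-≗ λ i → sym-M i j) (row-sum j)) ⟩
      t - s                                      ∎
      where open ≡-Reasoning

    -- By symmetry all column sums of t I - M equal t - s. Adding all rows to the top one makes it
    -- constant, and the constant factors out. This serves both A, with s = δ, and the deflated
    -- matrix, with s = 0.
    det-constant-row-sum : ∀ t → det (t ·I- M) ≡ (t - s) * det ((λ _ → 1ℚ) ∷ ((t ·I- M) ∘ suc))
    det-constant-row-sum t = begin
      det S
        ≡⟨ sum-of-rows det-alternating S ⟨
      det ((λ j → sum λ i → S i j) ∷ (S ∘ suc))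
        ≡⟨ det-cong (∷-cong {R = S ∘ suc} (λ j → trans (column-sum t j)
             (solve 1 (λ p → p := p :* con 1ℚ :+ con 0ℚ) refl (t - s))) (λ _ _ → refl)) ⟩
      det (axpy (t - s) (λ _ → 1ℚ) (λ _ → 0ℚ) ∷ (S ∘ suc))
        ≡⟨ linear-head det-alternating (t - s) (λ _ → 1ℚ) (λ _ → 0ℚ) (S ∘ suc) ⟩
      (t - s) * det ((λ _ → 1ℚ) ∷ (S ∘ suc)) + det ((λ _ → 0ℚ) ∷ (S ∘ suc))
        ≡⟨ cong ((t - s) * det ((λ _ → 1ℚ) ∷ (S ∘ suc)) +_) (zero-head det-alternating (S ∘ suc)) ⟩
      (t - s) * det ((λ _ → 1ℚ) ∷ (S ∘ suc)) + 0ℚ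
        ≡⟨ +-identityʳ _ ⟩
      (t - s) * det ((λ _ → 1ℚ) ∷ (S ∘ suc)) ∎
      where
      open ≡-Reasoning
      S = t ·I- M

  deflated : ∀ {n} → Rows n n → ℚ → Rows n n
  deflated A γ i j = A i j - γ

  deflated-symmetric : ∀ {n} {A : Rows n n} {γ} → Symmetric A → Symmetric (deflated A γ)
  deflated-symmetric {γ = γ} sym-A i j = cong (_- γ) (sym-A i j)

  -- The all-ones row is the sum of the rows of t I − A divided by t − δ; with it on top,
  -- adding a multiple of J to the other rows is a row operation.
  reduced : ∀ {n} → Rows (suc n) (suc n) → ℚ → ℚ
  reduced A t = det ((λ _ → 1ℚ) ∷ ((t ·I- A) ∘ suc))

  module _ {n} {A : Rows (suc n) (suc n)} (sym-A : Symmetric A) {δ γ} (row-sum : ∀ i → sum (A i) ≡ δ)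
           (deflating : ones (suc n) * γ ≡ δ) where

    -- Compared with det (t I - A) = (t - δ) · `reduced A t`, deflation moves the root δ to 0 and
    -- keeps the cofactor, without any division of polynomials.
    det-deflated : ∀ t → det (t ·I- deflated A γ) ≡ t * reduced A t
    det-deflated t = begin
      det (t ·I- deflated A γ)
        ≡⟨ det-constant-row-sum (deflated-symmetric sym-A) {0ℚ} deflated-row-sum t ⟩
      (t - 0ℚ) * det ((λ _ → 1ℚ) ∷ ((t ·I- deflated A γ) ∘ suc))
        ≡⟨ cong₂ _*_ (+-identityʳ t) reduced-deflated ⟩
      t * reduced A t ∎
      where
      open ≡-Reasoning
      rows≡ : ((t ·I- deflated A γ) ∘ suc) ≋ (λ i → axpy γ (λ _ → 1ℚ) ((t ·I- A) (suc i)))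
      rows≡ i j = solve 3 (λ t a γ → t :- (a :- γ) := γ :* con 1ℚ :+ (t :- a)) refl (t * I (suc i) j) (A (suc i) j) γ

      reduced-deflated : det ((λ _ → 1ℚ) ∷ ((t ·I- deflated A γ) ∘ suc)) ≡ reduced A t
      reduced-deflated = trans
        (det-cong (∷-cong {v = λ _ → 1ℚ} {λ _ → 1ℚ} {(t ·I- deflated A γ) ∘ suc} {λ i → axpy γ (λ _ → 1ℚ) ((t ·I- A) (suc i))}
          (λ _ → refl) rows≡))
        (add-head det-alternating (λ _ → 1ℚ) (λ _ → γ) ((t ·I- A) ∘ suc))

      deflated-row-sum : ∀ i → sum (deflated A γ i) ≡ 0ℚ
      deflated-row-sum i = begin
        sum (λ j → A i j - γ)                  ≡⟨ ∑-distrib-+ (A i) (λ _ → - γ) ⟩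
        sum (A i) + sum {suc n} (λ _ → - γ)    ≡⟨ cong₂ _+_ (row-sum i) (trans (sum-neg {suc n} (λ _ → γ)) (cong -_ (trans (sum-const {suc n} γ) deflating))) ⟩
        δ - δ                                  ≡⟨ +-inverseʳ δ ⟩
        0ℚ                                     ∎

  -- A lower bound from approximate eigenvalues

  -∣p∣*r≤p*q : ∀ p q {r} → ∣ q ∣ ≤ r → - (∣ p ∣ * r) ≤ p * q
  -∣p∣*r≤p*q p q {r} q≤r = begin
    - (∣ p ∣ * r)      ≤⟨ neg-antimono-≤ (*-monoˡ-≤ (0≤∣p∣ p) q≤r) ⟩
    - (∣ p ∣ * ∣ q ∣)  ≡⟨ cong -_ (∣p*q∣≡∣p∣*∣q∣ p q) ⟨
    - ∣ p * q ∣        ≡⟨ cong -_ (∣-p∣≡∣p∣ (p * q)) ⟨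
    - ∣ - (p * q) ∣    ≤⟨ neg-antimono-≤ (p≤∣p∣ (- (p * q))) ⟩
    - - (p * q)        ≡⟨ solve 1 (λ p → :- (:- p) := p) refl (p * q) ⟩
    p * q              ∎
    where open ≤-Reasoning

  product-lower-bound : ∀ {n} {r} {f : Vec n} → 0ℚ ≤ r → (∀ i → r ≤ f i) → r ^ n ≤ product f
  product-lower-bound {zero}  0≤r r≤f = ≤-refl
  product-lower-bound {suc n} 0≤r r≤f = *-mono-≤ 0≤r (r≤f zero) (0≤^ n 0≤r) (product-lower-bound 0≤r (r≤f ∘ suc))

  0<^ : ∀ {r} n → 0ℚ < r → 0ℚ < r ^ n
  0<^ zero    0<r = positive⁻¹ 1ℚ
  0<^ (suc n) 0<r = 0<* 0<r (0<^ n 0<r)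

  ¼ : ℚ
  ¼ = ½ * ½

  p≢0⇒0<∣p∣ : ∀ {p} → p ≢ 0ℚ → 0ℚ < ∣ p ∣
  p≢0⇒0<∣p∣ {p} p≢0 = ≰⇒> λ ∣p∣≤0 → p≢0 (∣p∣≡0⇒p≡0 p (≤-antisym ∣p∣≤0 (0≤∣p∣ p)))

  -- Here w = t - δ, w′ = t - μ₁ with μ₁ approximated, P is the product of the other factors and D
  -- is `reduced A t`. The sign of w is unknown, so the estimate is multiplied by w and w² > 0 is
  -- cancelled. The two tolerances leave ½ - ¼ = ¼ of ρ.
  quotient-lower-bound : ∀ {w w′ P D ρ} → w ≢ 0ℚ → 0ℚ ≤ ρ → ρ ≤ P →
                         ∣ w′ - w ∣ ≤ ∣ w ∣ * ½ → ∣ w * D - w′ * P ∣ ≤ ∣ w ∣ * (ρ * ¼) → ρ * ¼ ≤ D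
  quotient-lower-bound {w} {w′} {P} {D} {ρ} w≢0 0≤ρ ρ≤P w′≈w wD≈w′P = *-cancelˡ-≤ {w * w} 0<w² (begin
    w * w * (ρ * ¼)
      ≡⟨ solve 2 (λ w ρ → w :* w :* (ρ :* con ¼) := con ½ :* (w :* w) :* ρ :- w :* w :* (ρ :* con ¼)) refl w ρ ⟩
    ½ * (w * w) * ρ - w * w * (ρ * ¼)
      ≤⟨ +-monoˡ-≤ (- (w * w * (ρ * ¼))) (*-mono-≤ (0≤* (<⇒≤ 0<½) (0≤p*p w)) ½w²≤ww′ 0≤ρ ρ≤P) ⟩
    w * w′ * P - w * w * (ρ * ¼)
      ≡⟨ cong (λ p → w * w′ * P - p) (trans (cong (_* (ρ * ¼)) (sym (∣p∣*∣p∣≡p*p w))) (*-assoc ∣ w ∣ ∣ w ∣ (ρ * ¼))) ⟩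
    w * w′ * P - ∣ w ∣ * (∣ w ∣ * (ρ * ¼))
      ≤⟨ +-monoʳ-≤ (w * w′ * P) (-∣p∣*r≤p*q w (w * D - w′ * P) wD≈w′P) ⟩
    w * w′ * P + w * (w * D - w′ * P)
      ≡⟨ solve 4 (λ w v P D → w :* v :* P :+ w :* (w :* D :- v :* P) := w :* w :* D) refl w w′ P D ⟩
    w * w * D ∎)
    where
    open ≤-Reasoning
    0<w² : 0ℚ < w * w
    0<w² = subst (0ℚ <_) (∣p∣*∣p∣≡p*p w) (0<* (p≢0⇒0<∣p∣ w≢0) (p≢0⇒0<∣p∣ w≢0))
    ½w²≤ww′ : ½ * (w * w) ≤ w * w′
    ½w²≤ww′ = begin
      ½ * (w * w)                       ≡⟨ solve 1 (λ w → con ½ :* w := w :- w :* con ½) refl (w * w) ⟩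
      w * w - w * w * ½                 ≡⟨ cong (λ p → w * w - p) (trans (cong (_* ½) (sym (∣p∣*∣p∣≡p*p w))) (*-assoc ∣ w ∣ ∣ w ∣ ½)) ⟩
      w * w - ∣ w ∣ * (∣ w ∣ * ½)       ≤⟨ +-monoʳ-≤ (w * w) (-∣p∣*r≤p*q w (w′ - w) w′≈w) ⟩
      w * w + w * (w′ - w)              ≡⟨ solve 2 (λ w v → w :* w :+ w :* (v :- w) := w :* v) refl w w′ ⟩
      w * w′                            ∎

  Eventually : (ℕ → Set) → Set
  Eventually P = ∃[ N ] (∀ k → N ℕ.≤ k → P k)

  infixr 2 _&_
  _&_ : ∀ {P Q} → Eventually P → Eventually Q → Eventually (λ k → P k × Q k)
  (M , p) & (N , q) = M ℕ.⊔ N , λ k ≤k → p k (ℕ.m⊔n≤o⇒m≤o M N ≤k) , q k (ℕ.m⊔n≤o⇒n≤o M N ≤k)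

  sample : ∀ {P} → Eventually P → ∃[ k ] P k
  sample (N , p) = N , p N ℕ.≤-refl

  infix 4 _⟶_
  _⟶_ : (ℕ → ℚ) → ℚ → Set
  x ⟶ a = ∀ ε → 0ℚ < ε → Eventually λ k → ∣ a - x k ∣ < ε

  module _ {n} {A : Rows (suc n) (suc n)} (sym-A : Symmetric A) {δ γ} (row-sum : ∀ i → sum (A i) ≡ δ)
           (deflating : ones (suc n) * γ ≡ δ) (μ : ℕ → Vec (suc n))
           (spectrum : ∀ t → (λ k → product λ i → t - μ k i) ⟶ det (t ·I- A))
           (first : (λ k → μ k zero) ⟶ δ) where

    -- At t = δ the characteristic polynomial vanishes and says nothing about `reduced`.
    reduced-lower-bound : ∀ {ℓ L} → ℓ < L → Eventually (λ k → ∀ i → μ k (suc i) ≤ ℓ) →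
      ∀ t → L ≤ t → t ≢ δ → (L - ℓ) ^ n * ¼ ≤ reduced A t
    -- The conclusion does not mention k, so a single index at which all three approximations hold
    -- is enough.
    reduced-lower-bound {ℓ} {L} ℓ<L rest t L≤t t≢δ = bound (sample (first (∣ t - δ ∣ * ½) (0<* 0<∣w∣ 0<½)
        & spectrum t (∣ t - δ ∣ * ((L - ℓ) ^ n * ¼)) (0<* 0<∣w∣ (0<* 0<ρ (0<* 0<½ 0<½))) & rest))
      where
      open ≤-Reasoning
      D = reduced A t

      w≢0 : t - δ ≢ 0ℚ
      w≢0 eq = t≢δ (trans (solve 2 (λ t d → t := t :- d :+ d) refl t δ) (trans (cong (_+ δ) eq) (+-identityˡ δ)))

      0<∣w∣ : 0ℚ < ∣ t - δ ∣
      0<∣w∣ = p≢0⇒0<∣p∣ w≢0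

      0<L-ℓ : 0ℚ < L - ℓ
      0<L-ℓ = ≤-<-trans (≤-reflexive (sym (+-inverseʳ ℓ))) (+-monoˡ-< (- ℓ) ℓ<L)

      0<ρ : 0ℚ < (L - ℓ) ^ n
      0<ρ = 0<^ n 0<L-ℓ

      bound : ∃[ k ] (∣ δ - μ k zero ∣ < ∣ t - δ ∣ * ½ ×
                ∣ det (t ·I- A) - product (λ i → t - μ k i) ∣ < ∣ t - δ ∣ * ((L - ℓ) ^ n * ¼) ×
                (∀ i → μ k (suc i) ≤ ℓ)) → (L - ℓ) ^ n * ¼ ≤ D
      bound (k , μ₀≈δ , det≈ , μ≤ℓ) = quotient-lower-bound {t - δ} {t - μ k zero} {product λ i → t - μ k (suc i)}
        w≢0 (<⇒≤ 0<ρ)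
        (product-lower-bound (<⇒≤ 0<L-ℓ) λ i → +-mono-≤ L≤t (neg-antimono-≤ (μ≤ℓ i)))
        (≤-trans (≤-reflexive (cong ∣_∣ (solve 3 (λ t d m → t :- m :- (t :- d) := d :- m) refl t δ (μ k zero)))) (<⇒≤ μ₀≈δ))
        (≤-trans (≤-reflexive (cong (λ p → ∣ p - product (λ i → t - μ k i) ∣) (sym (det-constant-row-sum sym-A row-sum t)))) (<⇒≤ det≈))

    -- The extra root 0 of the deflated determinant is why L must be positive: the factor t is then
    -- at least L. The exceptional point handed to the descent is δ.
    deflated≼ : ∀ {ℓ L} → ℓ < L → 0ℚ < L → Eventually (λ k → ∀ i → μ k (suc i) ≤ ℓ) →
                deflated A γ ≼ L
    deflated≼ {ℓ} {L} ℓ<L 0<L rest = det-positive⇒≼ (deflated-symmetric sym-A)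
      {c = L * ((L - ℓ) ^ n * ¼)} (<⇒≤ 0<L) (0<* 0<L (0<* (0<^ n 0<L-ℓ) (0<* 0<½ 0<½))) δ λ t L≤t t≢δ → begin
        L * ((L - ℓ) ^ n * ¼)
          ≤⟨ *-mono-≤ (<⇒≤ 0<L) L≤t (<⇒≤ (0<* (0<^ n 0<L-ℓ) (0<* 0<½ 0<½))) (reduced-lower-bound ℓ<L rest t L≤t t≢δ) ⟩
        t * reduced A t
          ≡⟨ det-deflated sym-A row-sum deflating t ⟨
        det (t ·I- deflated A γ) ∎
      where
      open ≤-Reasoning
      0<L-ℓ : 0ℚ < L - ℓ
      0<L-ℓ = ≤-<-trans (≤-reflexive (sym (+-inverseʳ ℓ))) (+-monoˡ-< (- ℓ) ℓ<L)

-- Sums over subsets and double counting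

module Counting where

  open import Data.Bool.Base using (true; false; if_then_else_)
  open import Data.Fin.Base as Fin using (Fin; zero; suc)
  import Data.Fin.Properties as Fin
  open import Data.Fin.Subset using (Subset; inside; outside; ⊥; ⁅_⁆; _∈_; _∉_; _⊆_; _∩_; _∪_; _-_; ∣_∣)
  open import Data.Fin.Subset.Properties
  open import Data.List.Base using ([]; _∷_; _++_; map; filter; length; allFin; tabulate; cartesianProduct)
  import Data.List.Properties as List
  open import Data.Nat.Base using (_+_; _*_; _≤_; z≤n)
  import Data.Nat.ListAction as ListAction
  import Data.Nat.ListAction.Properties as ListAction
  open import Data.Nat.Properties
  open import Data.Vec.Base using ([]; _∷_)
  import Data.Vec.Properties as Vec
  open import Level using (Level)
  open import Relation.Unary using (Decidable)
  open import Algebra.Properties.Semiring.Sum +-*-semiring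
    using (sum; sum-cong-≗; ∑-distrib-+; *-distribʳ-sum)
  open import Defs using (Graph; neighbours; IsClique; isClique?; subsets; cliqueCount; edgeCount)

  private
    variable
      a b : Level
      X Y : Set a

  𝟙 : Dec X → ℕ
  𝟙 X? = if does X? then 1 else 0

  𝟙-mono : (X? : Dec X) (Y? : Dec Y) → (X → Y) → 𝟙 X? ≤ 𝟙 Y?
  𝟙-mono (yes x) Y? X→Y = ≤-reflexive (cong (if_then 1 else 0) (sym (dec-true Y? (X→Y x))))
  𝟙-mono (no  _) Y? X→Y = z≤n

  𝟙-cong : (X? : Dec X) (Y? : Dec Y) → (X → Y) → (Y → X) → 𝟙 X? ≡ 𝟙 Y?
  𝟙-cong X? Y? X→Y Y→X = ≤-antisym (𝟙-mono X? Y? X→Y) (𝟙-mono Y? X? Y→X)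

  𝟙-× : (X? : Dec X) (Y? : Dec Y) → 𝟙 (X? ×-dec Y?) ≡ 𝟙 X? * 𝟙 Y?
  𝟙-× X? Y? with does X?
  ... | true  = sym (+-identityʳ (𝟙 Y?))
  ... | false = refl

  sum-mono : ∀ {n} {f g : Fin n → ℕ} → (∀ i → f i ≤ g i) → sum f ≤ sum g
  sum-mono {zero}  f≤g = z≤n
  sum-mono {suc n} f≤g = +-mono-≤ (f≤g zero) (sum-mono (f≤g ∘ suc))

  length-filter : ∀ {A : Set a} {P : A → Set b} (P? : Decidable P) xs →
                  length (filter P? xs) ≡ ListAction.sum (map (𝟙 ∘ P?) xs)
  length-filter P? []       = refl
  length-filter P? (x ∷ xs) with does (P? x)
  ... | true  = cong suc (length-filter P? xs)
  ... | false = length-filter P? xs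

  sum-map-++ : ∀ {A : Set a} (f : A → ℕ) xs ys →
               ListAction.sum (map f (xs ++ ys)) ≡ ListAction.sum (map f xs) + ListAction.sum (map f ys)
  sum-map-++ f xs ys = trans (cong ListAction.sum (List.map-++ f xs ys)) (ListAction.sum-++ (map f xs) (map f ys))

  sum-map-tabulate : ∀ {A : Set a} {n} (f : A → ℕ) (g : Fin n → A) →
                     ListAction.sum (map f (tabulate g)) ≡ sum (f ∘ g)
  sum-map-tabulate {n = zero}  f g = refl
  sum-map-tabulate {n = suc n} f g = cong (f (g zero) +_) (sum-map-tabulate f (g ∘ suc))

  sum-map-cartesianProduct : ∀ {A : Set a} {B : Set b} (f : A × B → ℕ) xs ys →
    ListAction.sum (map f (cartesianProduct xs ys)) ≡ ListAction.sum (map (λ x → ListAction.sum (map (λ y → f (x , y)) ys)) xs)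
  sum-map-cartesianProduct f []       ys = refl
  sum-map-cartesianProduct f (x ∷ xs) ys = trans (sum-map-++ f (map (x ,_) ys) (cartesianProduct xs ys))
    (cong₂ _+_ (cong ListAction.sum (sym (List.map-∘ ys))) (sum-map-cartesianProduct f xs ys))

  -- Recursion on the ground set instead of a sum over the list of subsets, so that identities
  -- follow by splitting on the first element.
  Σ⊆ : ∀ {n} → (Subset n → ℕ) → ℕ
  Σ⊆ {zero}  f = f []
  Σ⊆ {suc n} f = Σ⊆ (f ∘ (outside ∷_)) + Σ⊆ (f ∘ (inside ∷_))

  sum-subsets : ∀ {n} (f : Subset n → ℕ) → ListAction.sum (map f (subsets n)) ≡ Σ⊆ f
  sum-subsets {zero}  f = +-identityʳ (f [])
  sum-subsets {suc n} f = trans (sum-map-++ f (map (outside ∷_) (subsets n)) (map (inside ∷_) (subsets n)))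
    (cong₂ _+_ (half outside) (half inside))
    where
    half : ∀ s → ListAction.sum (map f (map (s ∷_) (subsets n))) ≡ Σ⊆ (f ∘ (s ∷_))
    half s = trans (cong ListAction.sum (sym (List.map-∘ (subsets n)))) (sum-subsets (f ∘ (s ∷_)))

  Σ⊆-mono : ∀ {n} {f g : Subset n → ℕ} → (∀ K → f K ≤ g K) → Σ⊆ f ≤ Σ⊆ g
  Σ⊆-mono {zero}  f≤g = f≤g []
  Σ⊆-mono {suc n} f≤g = +-mono-≤ (Σ⊆-mono (f≤g ∘ (outside ∷_))) (Σ⊆-mono (f≤g ∘ (inside ∷_)))

  Σ⊆-cong : ∀ {n} {f g : Subset n → ℕ} → (∀ K → f K ≡ g K) → Σ⊆ f ≡ Σ⊆ g
  Σ⊆-cong {zero}  f≡g = f≡g []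
  Σ⊆-cong {suc n} f≡g = cong₂ _+_ (Σ⊆-cong (f≡g ∘ (outside ∷_))) (Σ⊆-cong (f≡g ∘ (inside ∷_)))

  Σ⊆-*ˡ : ∀ {n} c (f : Subset n → ℕ) → c * Σ⊆ f ≡ Σ⊆ (λ K → c * f K)
  Σ⊆-*ˡ {zero}  c f = refl
  Σ⊆-*ˡ {suc n} c f = trans (*-distribˡ-+ c (Σ⊆ (f ∘ (outside ∷_))) (Σ⊆ (f ∘ (inside ∷_))))
    (cong₂ _+_ (Σ⊆-*ˡ c (f ∘ (outside ∷_))) (Σ⊆-*ˡ c (f ∘ (inside ∷_))))

  Σ⊆-sum : ∀ {n m} (f : Fin m → Subset n → ℕ) → Σ⊆ (λ K → sum λ i → f i K) ≡ sum λ i → Σ⊆ (f i)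
  Σ⊆-sum {zero}  f = refl
  Σ⊆-sum {suc n} f = trans (cong₂ _+_ (Σ⊆-sum λ i → f i ∘ (outside ∷_)) (Σ⊆-sum λ i → f i ∘ (inside ∷_)))
    (sym (∑-distrib-+ (λ i → Σ⊆ (f i ∘ (outside ∷_))) (λ i → Σ⊆ (f i ∘ (inside ∷_)))))

  Σ⊆-zero : ∀ n → Σ⊆ {n} (λ _ → 0) ≡ 0
  Σ⊆-zero zero    = refl
  Σ⊆-zero (suc n) = cong₂ _+_ (Σ⊆-zero n) (Σ⊆-zero n)

  -- Removing v is injective on the subsets that contain v, so the left side sums f over the subsets
  -- that avoid v.
  Σ⊆-remove : ∀ {n} v (f : Subset n → ℕ) → Σ⊆ (λ K → 𝟙 (v ∈? K) * f (K - v)) ≤ Σ⊆ f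
  Σ⊆-remove {suc n} zero f = begin
    Σ⊆ {n} (λ _ → 0) + Σ⊆ (λ K → f ((inside ∷ K) - zero) + 0)
      ≡⟨ cong₂ _+_ (Σ⊆-zero n) (Σ⊆-cong λ K →
           trans (+-identityʳ _) (cong (λ p → f (outside ∷ p)) (p─⊥≡p K))) ⟩
    Σ⊆ (f ∘ (outside ∷_))
      ≤⟨ m≤m+n _ _ ⟩
    Σ⊆ f ∎
    where open ≤-Reasoning
  Σ⊆-remove {suc n} (suc v) f =
    +-mono-≤ (Σ⊆-remove v (f ∘ (outside ∷_))) (Σ⊆-remove v (f ∘ (inside ∷_)))

  ∣∣≡sum : ∀ {n} (K : Subset n) → ∣ K ∣ ≡ sum λ v → 𝟙 (v ∈? K)
  ∣∣≡sum []            = refl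
  ∣∣≡sum (inside  ∷ K) = cong suc (∣∣≡sum K)
  ∣∣≡sum (outside ∷ K) = ∣∣≡sum K

  suc∣p-x∣≡∣p∣ : ∀ {n} {v : Fin n} {K} → v ∈ K → suc ∣ K - v ∣ ≡ ∣ K ∣
  suc∣p-x∣≡∣p∣ {v = zero}  {inside  ∷ K} v∈K = cong (suc ∘ ∣_∣) (p─⊥≡p K)
  suc∣p-x∣≡∣p∣ {v = suc v} {inside  ∷ K} v∈K = cong suc (suc∣p-x∣≡∣p∣ (drop-there v∈K))
  suc∣p-x∣≡∣p∣ {v = suc v} {outside ∷ K} v∈K = suc∣p-x∣≡∣p∣ (drop-there v∈K)

  x∉p-x : ∀ {n} (v : Fin n) {K} → v ∉ K - v
  x∉p-x zero    {s ∷ K} ()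
  x∉p-x (suc v) {s ∷ K} v∈ = x∉p-x v (drop-there v∈)

  Σ⊆-size-0 : ∀ {n} (f : Subset n → ℕ) → Σ⊆ (λ K → 𝟙 (∣ K ∣ ≟ 0) * f K) ≡ f ⊥
  Σ⊆-size-0 {zero}  f = +-identityʳ (f [])
  Σ⊆-size-0 {suc n} f = trans (cong₂ _+_ (Σ⊆-size-0 (f ∘ (outside ∷_))) (Σ⊆-zero n)) (+-identityʳ _)

  Σ⊆-size-1 : ∀ {n} (f : Subset n → ℕ) → Σ⊆ (λ K → 𝟙 (∣ K ∣ ≟ 1) * f K) ≡ sum λ v → f ⁅ v ⁆
  Σ⊆-size-1 {zero}  f = refl
  Σ⊆-size-1 {suc n} f = trans (cong₂ _+_ (Σ⊆-size-1 (f ∘ (outside ∷_))) (Σ⊆-size-0 (f ∘ (inside ∷_)))) (+-comm _ (f (inside ∷ ⊥)))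

  -- A two-element set containing the first element is {0 , w} with w > 0; all others lie in the
  -- tail. The ordered pairs v < w match the way edges are counted.
  Σ⊆-size-2 : ∀ {n} (f : Subset n → ℕ) →
              Σ⊆ (λ K → 𝟙 (∣ K ∣ ≟ 2) * f K) ≡ sum λ v → sum λ w → 𝟙 (v Fin.<? w) * f (⁅ v ⁆ ∪ ⁅ w ⁆)
  Σ⊆-size-2 {zero}  f = refl
  Σ⊆-size-2 {suc n} f = begin
    Σ⊆ (λ K → 𝟙 (∣ K ∣ ≟ 2) * f (outside ∷ K)) + Σ⊆ (λ K → 𝟙 (∣ K ∣ ≟ 1) * f (inside ∷ K))
      ≡⟨ cong₂ _+_ (Σ⊆-size-2 (f ∘ (outside ∷_))) (Σ⊆-size-1 (f ∘ (inside ∷_))) ⟩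
    pairs + sum (λ w → f (inside ∷ ⁅ w ⁆))
      ≡⟨ +-comm pairs _ ⟩
    sum (λ w → f (inside ∷ ⁅ w ⁆)) + pairs
      ≡⟨ cong (_+ pairs) (sum-cong-≗ λ w → trans (cong (λ p → f (inside ∷ p)) (sym (∪-identityˡ ⁅ w ⁆))) (sym (+-identityʳ _))) ⟩
    sum (λ w → 1 * f (inside ∷ (⊥ ∪ ⁅ w ⁆))) + pairs ∎
    where
    open ≡-Reasoning
    pairs = sum λ v → sum λ w → 𝟙 (v Fin.<? w) * f (outside ∷ (⁅ v ⁆ ∪ ⁅ w ⁆))

  -- Counting cliques

  module _ {n} (G : Graph n) where
    open Graph G

    clique? : ∀ i B (K : Subset n) → Dec (K ⊆ B × ∣ K ∣ ≡ i × IsClique G K)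
    clique? i B K = (K ⊆? B) ×-dec (∣ K ∣ ≟ i) ×-dec isClique? G K

    cliqueCount≡Σ⊆ : ∀ i B → cliqueCount G i B ≡ Σ⊆ λ K → 𝟙 (clique? i B K)
    cliqueCount≡Σ⊆ i B = trans (length-filter (clique? i B) (subsets n)) (sum-subsets (𝟙 ∘ clique? i B))

    ∈-neighbours⁺ : ∀ {v w} → v ~ w → w ∈ neighbours G v
    ∈-neighbours⁺ {v} {w} v~w = Vec.lookup⇒[]= w _ (trans (Vec.lookup∘tabulate _ w) (dec-true (v ~? w) v~w))

    clique-remove : ∀ {i B K v} → v ∈ K → K ⊆ B × ∣ K ∣ ≡ suc i × IsClique G K →
                    v ∈ B × K - v ⊆ neighbours G v ∩ B × ∣ K - v ∣ ≡ i × IsClique G (K - v)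
    clique-remove {K = K} {v} v∈K (K⊆B , ∣K∣ , clique) =
        K⊆B v∈K
      , (λ {x} x∈K-v → x∈p∩q⁺ ( ∈-neighbours⁺ (clique v x v∈K (K-v⊆K x∈K-v) λ { refl → x∉p-x v {K} x∈K-v })
                              , K⊆B (K-v⊆K x∈K-v)))
      , suc-injective (trans (suc∣p-x∣≡∣p∣ v∈K) ∣K∣)
      , λ x y x∈ y∈ → clique x y (K-v⊆K x∈) (K-v⊆K y∈)
      where
      K-v⊆K : K - v ⊆ K
      K-v⊆K = p─q⊆p K ⁅ v ⁆

    cliqueCount-suc : ∀ i B → suc i * cliqueCount G (suc i) B ≤
                              sum λ v → 𝟙 (v ∈? B) * cliqueCount G i (neighbours G v ∩ B)
    cliqueCount-suc i B = begin
      suc i * cliqueCount G (suc i) B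
        ≡⟨ cong (suc i *_) (cliqueCount≡Σ⊆ (suc i) B) ⟩
      suc i * Σ⊆ (λ K → 𝟙 (clique? (suc i) B K))
        ≡⟨ Σ⊆-*ˡ (suc i) (λ K → 𝟙 (clique? (suc i) B K)) ⟩
      Σ⊆ (λ K → suc i * 𝟙 (clique? (suc i) B K))
        -- A counted clique has exactly `suc i` vertices, so the factor `suc i` becomes a sum over
        -- its vertices.
        ≡⟨ Σ⊆-cong weight ⟩
      Σ⊆ (λ K → sum λ v → 𝟙 (v ∈? K) * 𝟙 (clique? (suc i) B K))
        ≡⟨ Σ⊆-sum (λ v K → 𝟙 (v ∈? K) * 𝟙 (clique? (suc i) B K)) ⟩
      sum (λ v → Σ⊆ λ K → 𝟙 (v ∈? K) * 𝟙 (clique? (suc i) B K))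
        ≤⟨ sum-mono (λ v → Σ⊆-mono (remove v)) ⟩
      sum (λ v → Σ⊆ λ K → 𝟙 (v ∈? B) * (𝟙 (v ∈? K) * 𝟙 (clique? i (neighbours G v ∩ B) (K - v))))
        ≡⟨ sum-cong-≗ (λ v → Σ⊆-*ˡ (𝟙 (v ∈? B)) (λ K → 𝟙 (v ∈? K) * 𝟙 (clique? i (neighbours G v ∩ B) (K - v)))) ⟨
      sum (λ v → 𝟙 (v ∈? B) * Σ⊆ λ K → 𝟙 (v ∈? K) * 𝟙 (clique? i (neighbours G v ∩ B) (K - v)))
        ≤⟨ sum-mono (λ v → *-monoʳ-≤ (𝟙 (v ∈? B)) (Σ⊆-remove v (𝟙 ∘ clique? i (neighbours G v ∩ B)))) ⟩
      sum (λ v → 𝟙 (v ∈? B) * Σ⊆ λ K → 𝟙 (clique? i (neighbours G v ∩ B) K))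
        ≡⟨ sum-cong-≗ (λ v → cong (𝟙 (v ∈? B) *_) (cliqueCount≡Σ⊆ i (neighbours G v ∩ B))) ⟨
      sum (λ v → 𝟙 (v ∈? B) * cliqueCount G i (neighbours G v ∩ B)) ∎
      where
      open ≤-Reasoning
      weight : ∀ K → suc i * 𝟙 (clique? (suc i) B K) ≡ sum λ v → 𝟙 (v ∈? K) * 𝟙 (clique? (suc i) B K)
      weight K = trans (size (clique? (suc i) B K)) (trans (cong (_* 𝟙 (clique? (suc i) B K)) (∣∣≡sum K))
        (*-distribʳ-sum (𝟙 (clique? (suc i) B K)) (λ v → 𝟙 (v ∈? K))))
        where
        size : (C? : Dec (K ⊆ B × ∣ K ∣ ≡ suc i × IsClique G K)) → suc i * 𝟙 C? ≡ ∣ K ∣ * 𝟙 C?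
        size (yes (_ , ∣K∣ , _)) = cong (_* 1) (sym ∣K∣)
        size (no  _)             = trans (*-zeroʳ (suc i)) (sym (*-zeroʳ ∣ K ∣))
      remove : ∀ v K → 𝟙 (v ∈? K) * 𝟙 (clique? (suc i) B K) ≤
                       𝟙 (v ∈? B) * (𝟙 (v ∈? K) * 𝟙 (clique? i (neighbours G v ∩ B) (K - v)))
      remove v K = begin
        𝟙 (v ∈? K) * 𝟙 (clique? (suc i) B K)
          ≡⟨ 𝟙-× (v ∈? K) (clique? (suc i) B K) ⟨
        𝟙 ((v ∈? K) ×-dec clique? (suc i) B K)
          ≤⟨ 𝟙-mono ((v ∈? K) ×-dec clique? (suc i) B K) ((v ∈? B) ×-dec (v ∈? K) ×-dec clique? i (neighbours G v ∩ B) (K - v))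
               (λ (v∈K , C) → let v∈B , C′ = clique-remove v∈K C in v∈B , v∈K , C′) ⟩
        𝟙 ((v ∈? B) ×-dec (v ∈? K) ×-dec clique? i (neighbours G v ∩ B) (K - v))
          ≡⟨ trans (𝟙-× (v ∈? B) ((v ∈? K) ×-dec clique? i (neighbours G v ∩ B) (K - v)))
               (cong (𝟙 (v ∈? B) *_) (𝟙-× (v ∈? K) (clique? i (neighbours G v ∩ B) (K - v)))) ⟩
        𝟙 (v ∈? B) * (𝟙 (v ∈? K) * 𝟙 (clique? i (neighbours G v ∩ B) (K - v))) ∎

    cliqueCount-0≤1 : ∀ B → cliqueCount G 0 B ≤ 1
    cliqueCount-0≤1 B = begin
      cliqueCount G 0 B                     ≡⟨ cliqueCount≡Σ⊆ 0 B ⟩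
      Σ⊆ (λ K → 𝟙 (clique? 0 B K))          ≤⟨ Σ⊆-mono (λ K → 𝟙-mono (clique? 0 B K) (∣ K ∣ ≟ 0) (proj₁ ∘ proj₂)) ⟩
      Σ⊆ {n} (λ K → 𝟙 (∣ K ∣ ≟ 0))          ≡⟨ Σ⊆-cong {n} (λ K → sym (*-identityʳ (𝟙 (∣ K ∣ ≟ 0)))) ⟩
      Σ⊆ {n} (λ K → 𝟙 (∣ K ∣ ≟ 0) * 1)      ≡⟨ Σ⊆-size-0 {n} (λ _ → 1) ⟩
      1                                     ∎
      where open ≤-Reasoning

    -- The recursion `cliqueCount-suc` at i = 0, where each vertex of B contributes at most the
    -- empty clique.
    cliqueCount-1≤ : ∀ B → cliqueCount G 1 B ≤ ∣ B ∣
    cliqueCount-1≤ B = begin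
      cliqueCount G 1 B
        ≡⟨ *-identityˡ _ ⟨
      1 * cliqueCount G 1 B
        ≤⟨ cliqueCount-suc 0 B ⟩
      sum (λ v → 𝟙 (v ∈? B) * cliqueCount G 0 (neighbours G v ∩ B))
        ≤⟨ sum-mono (λ v → ≤-trans (*-monoʳ-≤ (𝟙 (v ∈? B)) (cliqueCount-0≤1 (neighbours G v ∩ B))) (≤-reflexive (*-identityʳ _))) ⟩
      sum (λ v → 𝟙 (v ∈? B))
        ≡⟨ ∣∣≡sum B ⟨
      ∣ B ∣ ∎
      where open ≤-Reasoning

    cliqueCount-2 : ∀ B → cliqueCount G 2 B ≡ edgeCount G B
    cliqueCount-2 B = begin
      cliqueCount G 2 B
        ≡⟨ cliqueCount≡Σ⊆ 2 B ⟩
      Σ⊆ (λ K → 𝟙 (clique? 2 B K))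
        -- The test on the size is pulled to the front to bring the sum into the shape of
        -- `Σ⊆-size-2`.
        ≡⟨ Σ⊆-cong (λ K → trans (𝟙-cong (clique? 2 B K) ((∣ K ∣ ≟ 2) ×-dec inside? K)
             (λ (K⊆B , ∣K∣ , C) → ∣K∣ , K⊆B , C) (λ (∣K∣ , K⊆B , C) → K⊆B , ∣K∣ , C))
             (𝟙-× (∣ K ∣ ≟ 2) (inside? K))) ⟩
      Σ⊆ (λ K → 𝟙 (∣ K ∣ ≟ 2) * 𝟙 (inside? K))
        ≡⟨ Σ⊆-size-2 (λ K → 𝟙 (inside? K)) ⟩
      sum (λ v → sum λ w → 𝟙 (v Fin.<? w) * 𝟙 (inside? (⁅ v ⁆ ∪ ⁅ w ⁆)))
        ≡⟨ sum-cong-≗ (λ v → sum-cong-≗ λ w → trans (sym (𝟙-× (v Fin.<? w) (inside? (⁅ v ⁆ ∪ ⁅ w ⁆))))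
             (𝟙-cong ((v Fin.<? w) ×-dec inside? (⁅ v ⁆ ∪ ⁅ w ⁆)) (edge? (v , w)) (pair⇒edge v w) (edge⇒pair v w))) ⟩
      sum (λ v → sum λ w → 𝟙 (edge? (v , w)))
        ≡⟨ trans (sum-map-tabulate (λ v → ListAction.sum (map (λ w → 𝟙 (edge? (v , w))) (allFin n))) id)
             (sum-cong-≗ λ v → sum-map-tabulate (λ w → 𝟙 (edge? (v , w))) id) ⟨
      ListAction.sum (map (λ v → ListAction.sum (map (λ w → 𝟙 (edge? (v , w))) (allFin n))) (allFin n))
        ≡⟨ sum-map-cartesianProduct (𝟙 ∘ edge?) (allFin n) (allFin n) ⟨
      ListAction.sum (map (𝟙 ∘ edge?) (cartesianProduct (allFin n) (allFin n)))
        ≡⟨ length-filter edge? (cartesianProduct (allFin n) (allFin n)) ⟨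
      edgeCount G B ∎
      where
      open ≡-Reasoning
      inside? : ∀ K → Dec (K ⊆ B × IsClique G K)
      inside? K = (K ⊆? B) ×-dec isClique? G K
      edge? : (e : Fin n × Fin n) →
              Dec (proj₁ e Fin.< proj₂ e × proj₁ e ~ proj₂ e × proj₁ e ∈ B × proj₂ e ∈ B)
      edge? (v , w) = (v Fin.<? w) ×-dec (v ~? w) ×-dec (v ∈? B) ×-dec (w ∈? B)
      pair⇒edge : ∀ v w → v Fin.< w × ⁅ v ⁆ ∪ ⁅ w ⁆ ⊆ B × IsClique G (⁅ v ⁆ ∪ ⁅ w ⁆) → v Fin.< w × v ~ w × v ∈ B × w ∈ B
      pair⇒edge v w (v<w , ⊆B , clique) = v<w , clique v w v∈ w∈ (Fin.<⇒≢ v<w) , ⊆B v∈ , ⊆B w∈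
        where
        v∈ = x∈p∪q⁺ {p = ⁅ v ⁆} {⁅ w ⁆} (inj₁ (x∈⁅x⁆ v))
        w∈ = x∈p∪q⁺ {p = ⁅ v ⁆} {⁅ w ⁆} (inj₂ (x∈⁅x⁆ w))
      edge⇒pair : ∀ v w → v Fin.< w × v ~ w × v ∈ B × w ∈ B → v Fin.< w × ⁅ v ⁆ ∪ ⁅ w ⁆ ⊆ B × IsClique G (⁅ v ⁆ ∪ ⁅ w ⁆)
      edge⇒pair v w (v<w , v~w , v∈B , w∈B) = v<w , ⊆B , clique
        where
        ⊆B : ⁅ v ⁆ ∪ ⁅ w ⁆ ⊆ B
        ⊆B x∈ with x∈p∪q⁻ ⁅ v ⁆ ⁅ w ⁆ x∈
        ... | inj₁ x∈v rewrite x∈⁅y⁆⇒x≡y v x∈v = v∈B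
        ... | inj₂ x∈w rewrite x∈⁅y⁆⇒x≡y w x∈w = w∈B
        clique : IsClique G (⁅ v ⁆ ∪ ⁅ w ⁆)
        clique x y x∈ y∈ x≢y with x∈p∪q⁻ ⁅ v ⁆ ⁅ w ⁆ x∈ | x∈p∪q⁻ ⁅ v ⁆ ⁅ w ⁆ y∈
        ... | inj₁ x∈v | inj₁ y∈v = contradiction (trans (x∈⁅y⁆⇒x≡y v x∈v) (sym (x∈⁅y⁆⇒x≡y v y∈v))) x≢y
        ... | inj₂ x∈w | inj₂ y∈w = contradiction (trans (x∈⁅y⁆⇒x≡y w x∈w) (sym (x∈⁅y⁆⇒x≡y w y∈w))) x≢y
        ... | inj₁ x∈v | inj₂ y∈w rewrite x∈⁅y⁆⇒x≡y v x∈v | x∈⁅y⁆⇒x≡y w y∈w = v~w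
        ... | inj₂ x∈w | inj₁ y∈v rewrite x∈⁅y⁆⇒x≡y w x∈w | x∈⁅y⁆⇒x≡y v y∈v = ~-sym v~w

-- From the quadratic form to degrees and cliques inside B

module InternalDegrees where

  open import Data.Bool.Base using (true; false)
  open import Data.Fin.Base using (Fin; zero; suc)
  open import Data.Fin.Subset using (Subset; _∈_; _∩_; ∣_∣)
  open import Data.Fin.Subset.Properties using (_∈?_; x∈p∩q⁺; x∈p∩q⁻; ∣p∩q∣≤∣q∣)
  open import Data.Nat.Base using (_!)
  open import Data.Rational.Base hiding (∣_∣)
  open import Data.Rational.Properties
  open import Data.Rational.Solver using (module +-*-Solver)
  import Data.Vec.Properties as Vec
  open import Algebra.Properties.Semiring.Sum ℕ.+-*-semiring using ()
    renaming (sum to sumℕ; sum-cong-≗ to sumℕ-cong; *-distribˡ-sum to *-distribˡ-sumℕ)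
  open import Algebra.Properties.CommutativeSemigroup ℕ.*-commutativeSemigroup using (x∙yz≈y∙xz)
  open import Defs using (Graph; neighbours; degree; cliqueCount)
  open Determinant
  open Spectral
  open Counting using (𝟙; 𝟙-cong; 𝟙-×; ∣∣≡sum; ∈-neighbours⁺; cliqueCount-suc; cliqueCount-1≤)
  open +-*-Solver using (solve; _:=_; _:+_; _:*_; _:-_; :-_)

  fromNat-sum : ∀ {n} (f : Fin n → ℕ) → fromNat (sumℕ f) ≡ sum (fromNat ∘ f)
  fromNat-sum {zero}  f = refl
  fromNat-sum {suc n} f = trans (fromNat-+ (f zero) (sumℕ (f ∘ suc))) (cong (fromNat (f zero) +_) (fromNat-sum (f ∘ suc)))

  module _ {n} (G : Graph n) where
    open Graph G

    adjacencyℚ : Rows n n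
    adjacencyℚ v w = fromNat (𝟙 (v ~? w))

    adjacencyℚ-symmetric : Symmetric adjacencyℚ
    adjacencyℚ-symmetric v w = cong fromNat (𝟙-cong (v ~? w) (w ~? v) ~-sym ~-sym)

    ∈-neighbours⁻ : ∀ {v w} → w ∈ neighbours G v → v ~ w
    ∈-neighbours⁻ {v} {w} w∈ with v ~? w | trans (sym (Vec.lookup∘tabulate (λ w → does (v ~? w)) w)) (Vec.[]=⇒lookup w∈)
    ... | yes v~w | _ = v~w

    adjacencyℚ-row-sum : ∀ v → sum (adjacencyℚ v) ≡ fromNat (degree G v)
    adjacencyℚ-row-sum v = trans (sym (fromNat-sum (λ w → 𝟙 (v ~? w)))) (cong fromNat (trans
      (sumℕ-cong λ w → 𝟙-cong (v ~? w) (w ∈? neighbours G v) (∈-neighbours⁺ G) ∈-neighbours⁻)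
      (sym (∣∣≡sum (neighbours G v)))))

    -- Twice the number of edges inside B. The degree sum is the form in which it appears both in
    -- the quadratic form at the indicator of B and in the clique recursion.
    internalDegrees : Subset n → ℕ
    internalDegrees B = sumℕ λ v → 𝟙 (v ∈? B) ℕ.* ∣ neighbours G v ∩ B ∣

    indicator : Subset n → Vec n
    indicator B v = fromNat (𝟙 (v ∈? B))

    sum-indicator : ∀ B → sum (indicator B) ≡ fromNat ∣ B ∣
    sum-indicator B = trans (sym (fromNat-sum (λ v → 𝟙 (v ∈? B)))) (cong fromNat (sym (∣∣≡sum B)))

    norm²-indicator : ∀ B → norm² (indicator B) ≡ fromNat ∣ B ∣
    norm²-indicator B = trans (sum-cong-≗ λ v → idempotent (v ∈? B)) (sum-indicator B)
      where
      idempotent : ∀ {X : Set} (X? : Dec X) → fromNat (𝟙 X?) * fromNat (𝟙 X?) ≡ fromNat (𝟙 X?)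
      idempotent X? with does X?
      ... | true  = refl
      ... | false = refl

    adjacencyℚ-indicator : ∀ B → dot (indicator B) (adjacencyℚ · indicator B) ≡ fromNat (internalDegrees B)
    adjacencyℚ-indicator B = sym (begin
      fromNat (internalDegrees B)
        ≡⟨ fromNat-sum (λ v → 𝟙 (v ∈? B) ℕ.* ∣ neighbours G v ∩ B ∣) ⟩
      sum (λ v → fromNat (𝟙 (v ∈? B) ℕ.* ∣ neighbours G v ∩ B ∣))
        ≡⟨ sum-cong-≗ (λ v → trans (fromNat-* (𝟙 (v ∈? B)) ∣ neighbours G v ∩ B ∣) (cong (indicator B v *_) (row v))) ⟩
      dot (indicator B) (adjacencyℚ · indicator B) ∎)
      where
      open ≡-Reasoning
      row : ∀ v → fromNat ∣ neighbours G v ∩ B ∣ ≡ (adjacencyℚ · indicator B) v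
      row v = begin
        fromNat ∣ neighbours G v ∩ B ∣
          ≡⟨ cong fromNat (trans (∣∣≡sum (neighbours G v ∩ B)) (sumℕ-cong λ w → trans
               (𝟙-cong (w ∈? neighbours G v ∩ B) ((v ~? w) ×-dec (w ∈? B))
                 (λ w∈ → let w∈N , w∈B = x∈p∩q⁻ (neighbours G v) B w∈ in ∈-neighbours⁻ w∈N , w∈B)
                 (λ (v~w , w∈B) → x∈p∩q⁺ (∈-neighbours⁺ G v~w , w∈B)))
               (𝟙-× (v ~? w) (w ∈? B)))) ⟩
        fromNat (sumℕ λ w → 𝟙 (v ~? w) ℕ.* 𝟙 (w ∈? B))
          ≡⟨ fromNat-sum (λ w → 𝟙 (v ~? w) ℕ.* 𝟙 (w ∈? B)) ⟩
        sum (λ w → fromNat (𝟙 (v ~? w) ℕ.* 𝟙 (w ∈? B)))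
          ≡⟨ sum-cong-≗ (λ w → fromNat-* (𝟙 (v ~? w)) (𝟙 (w ∈? B))) ⟩
        (adjacencyℚ · indicator B) v ∎

    -- Undoing the deflation adds γ (∑ x)² to the form; at the indicator of B both ∑ x and |x|²
    -- equal |B|.
    internalDegrees-bound : ∀ {γ L} → deflated adjacencyℚ γ ≼ L → ∀ B →
      fromNat (internalDegrees B) ≤ fromNat ∣ B ∣ * (γ * fromNat ∣ B ∣ + L)
    internalDegrees-bound {γ} {L} A≼L B = begin
      fromNat (internalDegrees B)
        ≡⟨ adjacencyℚ-indicator B ⟨
      dot x (adjacencyℚ · x)
        ≡⟨ solve 2 (λ p q → p := q :+ (p :- q)) refl (dot x (adjacencyℚ · x)) (γ * (sum x * sum x)) ⟩
      γ * (sum x * sum x) + (dot x (adjacencyℚ · x) - γ * (sum x * sum x))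
        ≡⟨ cong (γ * (sum x * sum x) +_) form ⟨
      γ * (sum x * sum x) + dot x (deflated adjacencyℚ γ · x)
        ≤⟨ +-monoʳ-≤ (γ * (sum x * sum x)) (A≼L x) ⟩
      γ * (sum x * sum x) + L * norm² x
        ≡⟨ cong₂ (λ p q → γ * (p * p) + L * q) (sum-indicator B) (norm²-indicator B) ⟩
      γ * (m * m) + L * m
        ≡⟨ solve 3 (λ γ L m → γ :* (m :* m) :+ L :* m := m :* (γ :* m :+ L)) refl γ L m ⟩
      m * (γ * m + L) ∎
      where
      open ≤-Reasoning
      x = indicator B
      m = fromNat ∣ B ∣
      row : ∀ v → (deflated adjacencyℚ γ · x) v ≡ axpy (- γ) (λ _ → sum x) (adjacencyℚ · x) v
      row v = trans (sum-linear (- γ) {g = x} {h = λ w → adjacencyℚ v w * x w} λ w →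
        solve 3 (λ a γ x → (a :- γ) :* x := :- γ :* x :+ a :* x) refl (adjacencyℚ v w) γ (x w)) refl
      form : dot x (deflated adjacencyℚ γ · x) ≡ dot x (adjacencyℚ · x) - γ * (sum x * sum x)
      form = trans (dot-congʳ x {deflated adjacencyℚ γ · x} row)
        (trans (dot-axpyʳ x (- γ) (λ _ → sum x) (adjacencyℚ · x))
          (trans (cong (λ p → - γ * p + dot x (adjacencyℚ · x)) (sym (*-distribʳ-sum (sum x) x)))
            (solve 3 (λ γ s q → :- γ :* s :+ q := q :- γ :* s) refl γ (sum x * sum x) (dot x (adjacencyℚ · x)))))

    module _ (z : ℕ → ℚ) (0≤z : ∀ m → 0ℚ ≤ z m) (z-mono : ∀ {k m} → k ℕ.≤ m → z k ≤ z m)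
             (degrees≤ : ∀ B → fromNat (internalDegrees B) ≤ fromNat ∣ B ∣ * z ∣ B ∣) where

      -- Induction on i for all B simultaneously, applied to N(v) ∩ B for v in B. Monotonicity
      -- replaces the power of z at the smaller set by that at B. The remaining factors |N(v) ∩ B|
      -- sum to `internalDegrees B`, which supplies |B| and one more factor z. Keeping the factorial
      -- on the left avoids division.
      cliqueCount-bound : ∀ i B → fromNat (suc i ! ℕ.* cliqueCount G (suc i) B) ≤ fromNat ∣ B ∣ * z ∣ B ∣ ^ i
      cliqueCount-bound zero B = begin
        fromNat (1 ℕ.* cliqueCount G 1 B)  ≤⟨ fromNat-mono (ℕ.≤-trans (ℕ.≤-reflexive (ℕ.*-identityˡ _)) (cliqueCount-1≤ G B)) ⟩
        fromNat ∣ B ∣                      ≡⟨ *-identityʳ (fromNat ∣ B ∣) ⟨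
        fromNat ∣ B ∣ * 1ℚ                 ∎
        where open ≤-Reasoning
      cliqueCount-bound (suc i) B = begin
        fromNat (suc (suc i) ! ℕ.* c)
          ≡⟨ cong fromNat (trans (cong (ℕ._* c) (ℕ.*-comm (suc (suc i)) (suc i !))) (ℕ.*-assoc (suc i !) (suc (suc i)) c)) ⟩
        fromNat (suc i ! ℕ.* (suc (suc i) ℕ.* c))
          ≤⟨ fromNat-mono (ℕ.*-monoʳ-≤ (suc i !) (cliqueCount-suc G (suc i) B)) ⟩
        fromNat (suc i ! ℕ.* sumℕ (λ v → 𝟙 (v ∈? B) ℕ.* cliqueCount G (suc i) (N v)))
          ≡⟨ cong fromNat (trans (*-distribˡ-sumℕ (suc i !) (λ v → 𝟙 (v ∈? B) ℕ.* cliqueCount G (suc i) (N v)))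
               (sumℕ-cong λ v → x∙yz≈y∙xz (suc i !) (𝟙 (v ∈? B)) (cliqueCount G (suc i) (N v)))) ⟩
        fromNat (sumℕ (λ v → 𝟙 (v ∈? B) ℕ.* (suc i ! ℕ.* cliqueCount G (suc i) (N v))))
          ≡⟨ trans (fromNat-sum (λ v → 𝟙 (v ∈? B) ℕ.* (suc i ! ℕ.* cliqueCount G (suc i) (N v))))
               (sum-cong-≗ λ v → fromNat-* (𝟙 (v ∈? B)) (suc i ! ℕ.* cliqueCount G (suc i) (N v))) ⟩
        sum (λ v → indicator B v * fromNat (suc i ! ℕ.* cliqueCount G (suc i) (N v)))
          ≤⟨ sum-mono (λ v → *-monoˡ-≤ (0≤fromNat (𝟙 (v ∈? B))) (local v)) ⟩
        sum (λ v → indicator B v * (fromNat ∣ N v ∣ * z ∣ B ∣ ^ i))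
          ≡⟨ sum-cong-≗ (λ v → trans (sym (*-assoc (indicator B v) (fromNat ∣ N v ∣) (z ∣ B ∣ ^ i)))
               (cong (_* z ∣ B ∣ ^ i) (sym (fromNat-* (𝟙 (v ∈? B)) ∣ N v ∣)))) ⟩
        sum (λ v → fromNat (𝟙 (v ∈? B) ℕ.* ∣ N v ∣) * z ∣ B ∣ ^ i)
          ≡⟨ *-distribʳ-sum (z ∣ B ∣ ^ i) (λ v → fromNat (𝟙 (v ∈? B) ℕ.* ∣ N v ∣)) ⟨
        sum (λ v → fromNat (𝟙 (v ∈? B) ℕ.* ∣ N v ∣)) * z ∣ B ∣ ^ i
          ≡⟨ cong (_* z ∣ B ∣ ^ i) (fromNat-sum (λ v → 𝟙 (v ∈? B) ℕ.* ∣ N v ∣)) ⟨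
        fromNat (internalDegrees B) * z ∣ B ∣ ^ i
          ≤⟨ *-monoʳ-≤-nonNeg (z ∣ B ∣ ^ i) {{nonNegative (0≤^ i (0≤z ∣ B ∣))}} (degrees≤ B) ⟩
        fromNat ∣ B ∣ * z ∣ B ∣ * z ∣ B ∣ ^ i
          ≡⟨ *-assoc (fromNat ∣ B ∣) (z ∣ B ∣) (z ∣ B ∣ ^ i) ⟩
        fromNat ∣ B ∣ * z ∣ B ∣ ^ suc i ∎
        where
        open ≤-Reasoning
        c = cliqueCount G (suc (suc i)) B
        N : Fin n → Subset n
        N v = neighbours G v ∩ B
        local : ∀ v → fromNat (suc i ! ℕ.* cliqueCount G (suc i) (N v)) ≤ fromNat ∣ N v ∣ * z ∣ B ∣ ^ i
        local v = ≤-trans (cliqueCount-bound i (N v)) (*-monoˡ-≤ (0≤fromNat ∣ N v ∣)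
          (^-mono i (0≤z ∣ N v ∣) (z-mono (∣p∩q∣≤∣q∣ (neighbours G v) B))))

-- Real numbers through their rational terms

module RealBounds where

  open import Data.Bool.Base using (true; false)
  open import Data.Fin.Base using (Fin; zero; suc; toℕ; punchIn)
  import Data.Fin.Properties as Fin
  open import Data.Fin.Subset using () renaming (∣_∣ to size)
  import Data.Integer.Base as ℤ
  open import Data.Nat.Base using (_!; z≤n; s≤s)
  open import Data.Rational.Base hiding (_÷_)
  open import Data.Rational.Properties
  open import Data.Rational.Solver using (module +-*-Solver)
  open import Defs using (ℝ; seq; cauchy; fromℚ; fromℕ; _÷_; θ; identity; charPoly;
    Graph; degree; adjacency; IsNDΛGraph; cliqueCount)
  import Defs as ℝ
  open Determinant
  open Spectral
  open InternalDegrees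
  open +-*-Solver using (solve; _:=_; _:+_; _:*_; _:-_; :-_; con)

  seq-sum : ∀ {n} (f : Fin n → ℝ) k → seq (ℝ.sum f) k ≡ sum λ i → seq (f i) k
  seq-sum {zero}  f k = refl
  seq-sum {suc n} f k = cong (seq (f zero) k +_) (seq-sum (f ∘ suc) k)

  seq-product : ∀ {n} (f : Fin n → ℝ) k → seq (ℝ.product f) k ≡ product λ i → seq (f i) k
  seq-product {zero}  f k = refl
  seq-product {suc n} f k = cong (seq (f zero) k *_) (seq-product (f ∘ suc) k)

  seq-^ : ∀ x n k → seq (x ℝ.^ n) k ≡ seq x k ^ n
  seq-^ x zero    k = refl
  seq-^ x (suc n) k = cong (seq x k *_) (seq-^ x n k)

  seq-det : ∀ {n} (M : ℝ.Matrix n) k → seq (ℝ.det M) k ≡ det λ i j → seq (M i j) k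
  seq-det {zero}  M k = refl
  seq-det {suc n} M k = trans
    (seq-sum (λ j → (ℝ.- ℝ.1ℝ) ℝ.^ toℕ j ℝ.* M zero j ℝ.* ℝ.det (λ i l → M (suc i) (punchIn j l))) k)
    (sum-cong-≗ λ j → cong₂ (λ s d → s * seq (M zero j) k * d)
      (seq-^ (ℝ.- ℝ.1ℝ) (toℕ j) k) (seq-det (λ i l → M (suc i) (punchIn j l)) k))

  -- At a rational t the sequence is constant in k, so the hypothesis on the spectrum becomes
  -- convergence to a fixed rational number.
  seq-charPoly : ∀ {n} (G : Graph n) t k → seq (charPoly (adjacency G) (fromℚ t)) k ≡ det (t ·I- adjacencyℚ G)
  seq-charPoly G t k = trans
    (seq-det (λ i j → fromℚ t ℝ.* identity i j ℝ.- adjacency G i j) k) (det-cong λ i j →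
    cong₂ (λ p q → t * p - q) (seq-identity i j) (seq-adjacency i j))
    where
    open Graph G
    seq-identity : ∀ i j → seq (identity i j) k ≡ I i j
    seq-identity i j with does (i Fin.≟ j)
    ... | true  = refl
    ... | false = refl
    seq-adjacency : ∀ i j → seq (adjacency G i j) k ≡ adjacencyℚ G i j
    seq-adjacency i j with does (i ~? j)
    ... | true  = refl
    ... | false = refl

  ∣p-q∣≡∣q-p∣ : ∀ p q → ∣ p - q ∣ ≡ ∣ q - p ∣
  ∣p-q∣≡∣q-p∣ p q = trans (sym (∣-p∣≡∣p∣ (p - q))) (cong ∣_∣ (solve 2 (λ p q → :- (p :- q) := q :- p) refl p q))

  spectrum⇒⟶ : ∀ {n} (G : Graph n) (μ : Fin n → ℝ) → ℝ.IsSpectrum (adjacency G) μ →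
                ∀ t → (λ k → product λ i → t - seq (μ i) k) ⟶ det (t ·I- adjacencyℚ G)
  spectrum⇒⟶ G μ spectrum t ε 0<ε = let N , close = spectrum (fromℚ t) ε 0<ε in N , λ k N≤k → begin-strict
    ∣ det (t ·I- adjacencyℚ G) - product (λ i → t - seq (μ i) k) ∣
      ≡⟨ cong₂ (λ p q → ∣ p - q ∣) (seq-charPoly G t k) (seq-product (λ i → fromℚ t ℝ.- μ i) k) ⟨
    ∣ seq (charPoly (adjacency G) (fromℚ t)) k - seq (ℝ.product (λ i → fromℚ t ℝ.- μ i)) k ∣
      <⟨ close k N≤k ⟩
    ε ∎
    where open ≤-Reasoning

  ∣p-q∣<r⇒p<q+r : ∀ p q {r} → ∣ p - q ∣ < r → p < q + r
  ∣p-q∣<r⇒p<q+r p q {r} p≈q = begin-strict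
    p              ≡⟨ solve 2 (λ p q → p := q :+ (p :- q)) refl p q ⟩
    q + (p - q)    ≤⟨ +-monoʳ-≤ q (p≤∣p∣ (p - q)) ⟩
    q + ∣ p - q ∣  <⟨ +-monoʳ-< q p≈q ⟩
    q + r          ∎
    where open ≤-Reasoning

  eventually-map : ∀ {P Q : ℕ → Set} → (∀ {k} → P k → Q k) → Eventually P → Eventually Q
  eventually-map f (N , p) = N , λ k N≤k → f (p k N≤k)

  eventually-all : ∀ {n} {P : Fin n → ℕ → Set} → (∀ i → Eventually (P i)) → Eventually λ k → ∀ i → P i k
  eventually-all {zero}  p = 0 , λ _ _ ()
  eventually-all {suc n} p = eventually-map (λ (p₀ , pₛ) → λ { zero → p₀ ; (suc i) → pₛ i }) (p zero & eventually-all (p ∘ suc))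

  settled : ∀ x {δ} → 0ℚ < δ → ∃[ K ] Eventually λ k → ∣ seq x K - seq x k ∣ < δ
  settled x {δ} 0<δ = let N , close = cauchy x δ 0<δ in N , N , λ k N≤k → close N k ℕ.≤-refl N≤k

  bounded-seq : ∀ x → ∃[ Y ] (0ℚ ≤ Y × Eventually λ k → ∣ seq x k ∣ ≤ Y)
  bounded-seq x with settled x {1ℚ} (positive⁻¹ 1ℚ)
  ... | K , close = ∣ seq x K ∣ + 1ℚ , 0≤+ (0≤∣p∣ (seq x K)) 0≤1 , eventually-map (λ {k} xK≈xk → begin
    ∣ seq x k ∣
      ≡⟨ cong ∣_∣ (solve 2 (λ p q → p := q :- (q :- p)) refl (seq x k) (seq x K)) ⟩
    ∣ seq x K - (seq x K - seq x k) ∣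
      ≤⟨ ∣p-q∣≤∣p∣+∣q∣ (seq x K) (seq x K - seq x k) ⟩
    ∣ seq x K ∣ + ∣ seq x K - seq x k ∣
      ≤⟨ +-monoʳ-≤ ∣ seq x K ∣ (<⇒≤ xK≈xk) ⟩
    ∣ seq x K ∣ + 1ℚ ∎) close
    where open ≤-Reasoning

  -- A graph on a single vertex is 0-regular.
  another-vertex : ∀ {n d} {{_ : ℕ.NonZero d}} (G : Graph (suc n)) → degree G zero ≡ d → Fin n
  another-vertex {suc n}     G eq = zero
  another-vertex {zero}  {d} G eq with Graph._~?_ G zero zero
  ... | yes 0~0 = contradiction 0~0 (Graph.~-irrefl G refl)
  ... | no  _   = contradiction (sym eq) (ℕ.≢-nonZero⁻¹ d)

  ^-lipschitz : ∀ K → 0ℚ ≤ K → ∀ n → ∃[ C ] (0ℚ ≤ C ×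
                (∀ a b → ∣ a ∣ ≤ K → ∣ b ∣ ≤ K → ∣ a ^ n - b ^ n ∣ ≤ C * ∣ a - b ∣))
  ^-lipschitz K 0≤K zero    = 0ℚ , ≤-refl , λ a b _ _ → ≤-reflexive (sym (*-zeroˡ ∣ a - b ∣))
  ^-lipschitz K 0≤K (suc n) with ^-lipschitz K 0≤K n
  ... | C , 0≤C , lipschitz = K * C + K ^ n , 0≤+ (0≤* 0≤K 0≤C) (0≤^ n 0≤K) , λ a b a≤K b≤K → begin
    ∣ a * a ^ n - b * b ^ n ∣
      ≡⟨ cong ∣_∣ (solve 4 (λ a b A B → a :* A :- b :* B := a :* (A :- B) :+ B :* (a :- b)) refl a b (a ^ n) (b ^ n)) ⟩
    ∣ a * (a ^ n - b ^ n) + b ^ n * (a - b) ∣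
      ≤⟨ ∣p+q∣≤∣p∣+∣q∣ (a * (a ^ n - b ^ n)) (b ^ n * (a - b)) ⟩
    ∣ a * (a ^ n - b ^ n) ∣ + ∣ b ^ n * (a - b) ∣
      ≡⟨ cong₂ _+_ (∣p*q∣≡∣p∣*∣q∣ a (a ^ n - b ^ n)) (∣p*q∣≡∣p∣*∣q∣ (b ^ n) (a - b)) ⟩
    ∣ a ∣ * ∣ a ^ n - b ^ n ∣ + ∣ b ^ n ∣ * ∣ a - b ∣
      ≤⟨ +-mono-≤ (*-mono-≤ (0≤∣p∣ a) a≤K (0≤∣p∣ (a ^ n - b ^ n)) (lipschitz a b a≤K b≤K))
           (*-monoʳ-≤-nonNeg ∣ a - b ∣ {{∣-∣-nonNeg (a - b)}} (∣^∣≤ b n b≤K)) ⟩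
    K * (C * ∣ a - b ∣) + K ^ n * ∣ a - b ∣
      ≡⟨ solve 4 (λ K C p x → K :* (C :* x) :+ p :* x := (K :* C :+ p) :* x) refl K C (K ^ n) ∣ a - b ∣ ⟩
    (K * C + K ^ n) * ∣ a - b ∣ ∎
    where
    open ≤-Reasoning
    ∣^∣≤ : ∀ b n → ∣ b ∣ ≤ K → ∣ b ^ n ∣ ≤ K ^ n
    ∣^∣≤ b zero    b≤K = ≤-refl
    ∣^∣≤ b (suc n) b≤K = ≤-trans (≤-reflexive (∣p*q∣≡∣p∣*∣q∣ b (b ^ n)))
      (*-mono-≤ (0≤∣p∣ b) b≤K (0≤∣p∣ (b ^ n)) (∣^∣≤ b n b≤K))

  -- The choice δ = e / (a + e) with e = ε/2 also covers a = 0 and never exceeds 1.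
  small : ∀ {a ε} → 0ℚ ≤ a → 0ℚ < ε → ∃[ δ ] (0ℚ < δ × δ ≤ 1ℚ × a * δ < ε)
  small {a} {ε} 0≤a 0<ε = T * e , 0<* 0<T 0<e , δ≤1 , aδ<ε
    where
    open ≤-Reasoning
    e T : ℚ
    e = ½ * ε
    0<e : 0ℚ < e
    0<e = 0<* 0<½ 0<ε
    0<a+e : 0ℚ < a + e
    0<a+e = +-mono-≤-< 0≤a 0<e
    T = proj₁ (inverse 0<a+e)
    0<T : 0ℚ < T
    0<T = proj₁ (proj₂ (inverse 0<a+e))
    T[a+e]≡1 : T * (a + e) ≡ 1ℚ
    T[a+e]≡1 = proj₂ (proj₂ (inverse 0<a+e))
    δ≤1 : T * e ≤ 1ℚ
    δ≤1 = begin
      T * e         ≡⟨ cong (T *_) (+-identityˡ e) ⟨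
      T * (0ℚ + e)  ≤⟨ *-monoˡ-≤ (<⇒≤ 0<T) (+-monoˡ-≤ e 0≤a) ⟩
      T * (a + e)   ≡⟨ T[a+e]≡1 ⟩
      1ℚ            ∎
    aδ<ε : a * (T * e) < ε
    aδ<ε = begin-strict
      a * (T * e)         ≡⟨ solve 3 (λ a T e → a :* (T :* e) := T :* a :* e) refl a T e ⟩
      T * a * e           ≤⟨ *-monoʳ-≤-nonNeg e {{nonNegative (<⇒≤ 0<e)}} (*-monoˡ-≤ (<⇒≤ 0<T) (p≤p+q a (<⇒≤ 0<e))) ⟩
      T * (a + e) * e     ≡⟨ cong (_* e) T[a+e]≡1 ⟩
      1ℚ * e              ≡⟨ *-identityˡ e ⟩
      e                   ≡⟨ +-identityʳ e ⟨
      e + 0ℚ              <⟨ +-monoʳ-< e 0<e ⟩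
      e + e               ≡⟨ solve 1 (λ ε → con ½ :* ε :+ con ½ :* ε := ε) refl ε ⟩
      ε                   ∎

  -- δ must be uniform in x, since x will be a term of the sequence of dθ while δ is fixed before
  -- the index. As δ ≤ 1, both x and x + δ stay within Y + 1, where the power is Lipschitz.
  perturbation : ∀ {Y r ε} → 0ℚ ≤ Y → 0ℚ ≤ r → 0ℚ < ε → ∀ n →
                 ∃[ δ ] (0ℚ < δ × (∀ x → ∣ x ∣ ≤ Y → r * (x + δ) ^ n < r * x ^ n + ε))
  perturbation {Y} {r} {ε} 0≤Y 0≤r 0<ε n =
    let C , 0≤C , lipschitz = ^-lipschitz (Y + 1ℚ) (0≤+ 0≤Y 0≤1) n
        δ , 0<δ , δ≤1 , rCδ<ε = small (0≤* 0≤r 0≤C) 0<ε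
    in δ , 0<δ , λ x x≤Y → bound C δ x (<⇒≤ 0<δ) rCδ<ε (lipschitz (x + δ) x
         (≤-trans (∣p+q∣≤∣p∣+∣q∣ x δ) (+-mono-≤ x≤Y (≤-trans (≤-reflexive (0≤p⇒∣p∣≡p (<⇒≤ 0<δ))) δ≤1)))
         (≤-trans x≤Y (p≤p+q Y 0≤1)))
    where
    open ≤-Reasoning
    bound : ∀ C δ x → 0ℚ ≤ δ → r * C * δ < ε → ∣ (x + δ) ^ n - x ^ n ∣ ≤ C * ∣ x + δ - x ∣ →
            r * (x + δ) ^ n < r * x ^ n + ε
    bound C δ x 0≤δ rCδ<ε lipschitz = begin-strict
      r * (x + δ) ^ n
        ≡⟨ solve 3 (λ r p q → r :* p := r :* q :+ r :* (p :- q)) refl r ((x + δ) ^ n) (x ^ n) ⟩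
      r * x ^ n + r * ((x + δ) ^ n - x ^ n)
        ≤⟨ +-monoʳ-≤ (r * x ^ n) (*-monoˡ-≤ 0≤r (≤-trans (p≤∣p∣ ((x + δ) ^ n - x ^ n)) lipschitz)) ⟩
      r * x ^ n + r * (C * ∣ x + δ - x ∣)
        ≡⟨ cong (λ p → r * x ^ n + r * (C * ∣ p ∣)) (solve 2 (λ x δ → x :+ δ :- x := δ) refl x δ) ⟩
      r * x ^ n + r * (C * ∣ δ ∣)
        ≡⟨ cong (λ p → r * x ^ n + r * (C * p)) (0≤p⇒∣p∣≡p 0≤δ) ⟩
      r * x ^ n + r * (C * δ)
        ≡⟨ cong (r * x ^ n +_) (*-assoc r C δ) ⟨
      r * x ^ n + r * C * δ
        <⟨ +-monoʳ-< (r * x ^ n) rCδ<ε ⟩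
      r * x ^ n + ε ∎

  -- The bounds for the graph

  module _ {n d : ℕ} {{_ : ℕ.NonZero d}} {Λ : ℝ} (G : Graph (suc n)) (ndΛ : IsNDΛGraph G d Λ) where
    open Graph G
    open IsNDΛGraph ndΛ

    density : ℚ
    density = fromNat d * (ℤ.+ 1 / suc n)

    μ : ℕ → Vec (suc n)
    μ k i = seq (eigenvalue i) k

    μ-spectrum : ∀ t → (λ k → product λ i → t - μ k i) ⟶ det (t ·I- adjacencyℚ G)
    μ-spectrum = spectrum⇒⟶ G eigenvalue isSpectrum

    μ-first : (λ k → μ k zero) ⟶ fromNat d
    μ-first ε 0<ε = eventually-map (λ {k} → subst (_< ε) (∣p-q∣≡∣q-p∣ (μ k zero) (fromNat d))) (first zero refl ε 0<ε)

    deflating : ones (suc n) * density ≡ fromNat d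
    deflating = begin
      ones (suc n) * (fromNat d * r)      ≡⟨ cong (_* (fromNat d * r)) (ones≡fromNat (suc n)) ⟩
      fromNat (suc n) * (fromNat d * r)   ≡⟨ solve 3 (λ n d r → n :* (d :* r) := d :* (n :* r)) refl (fromNat (suc n)) (fromNat d) r ⟩
      fromNat d * (fromNat (suc n) * r)   ≡⟨ cong (fromNat d *_) (fromNat-inverse (suc n)) ⟩
      fromNat d * 1ℚ                      ≡⟨ *-identityʳ (fromNat d) ⟩
      fromNat d                           ∎
      where
      open ≡-Reasoning
      r = ℤ.+ 1 / suc n

    spectral-gap : ∀ {δ} → 0ℚ < δ →
      ∃[ L ] (0ℚ < L × deflated (adjacencyℚ G) density ≼ L × Eventually λ k → L ≤ seq Λ k + δ)
    spectral-gap {δ} 0<δ = L , 0<L , deflated≼ (adjacencyℚ-symmetric G)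
        (λ v → trans (adjacencyℚ-row-sum G v) (cong fromNat (regular v))) deflating μ μ-spectrum μ-first
        ℓ<L 0<L μ≤ℓ , L≤Λ+δ
      where
      open ≤-Reasoning
      -- A quarter of δ, spent four times: on the tolerance in `nontrivial`, on passing from
      -- `seq Λ k` to `seq Λ K`, on the strict gap between ℓ and L, and on passing back to
      -- `seq Λ k`.
      η : ℚ
      η = ½ * (½ * δ)

      0<η : 0ℚ < η
      0<η = 0<* 0<½ (0<* 0<½ 0<δ)

      K : ℕ
      K = proj₁ (settled Λ 0<η)

      close : Eventually λ k → ∣ seq Λ K - seq Λ k ∣ < η
      close = proj₂ (settled Λ 0<η)

      ℓ L : ℚ
      ℓ = seq Λ K + η + η
      L = ℓ + η

      ℓ<L : ℓ < L
      ℓ<L = begin-strict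
        ℓ        ≡⟨ +-identityʳ ℓ ⟨
        ℓ + 0ℚ   <⟨ +-monoʳ-< ℓ 0<η ⟩
        L        ∎

      ∣μ∣<ℓ : Eventually λ k → ∀ i → ∣ μ k (suc i) ∣ < ℓ
      ∣μ∣<ℓ = eventually-map (λ {k} (μ< , ΛK≈Λk) i → begin-strict
        ∣ μ k (suc i) ∣       <⟨ μ< i ⟩
        seq Λ k + η           <⟨ +-monoˡ-< η (∣p-q∣<r⇒p<q+r (seq Λ k) (seq Λ K) (subst (_< η) (∣p-q∣≡∣q-p∣ (seq Λ K) (seq Λ k)) ΛK≈Λk)) ⟩
        ℓ                     ∎)
        (eventually-all (λ i → nontrivial (suc i) (s≤s z≤n) η 0<η) & close)

      μ≤ℓ : Eventually λ k → ∀ i → μ k (suc i) ≤ ℓ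
      μ≤ℓ = eventually-map (λ {k} μ<ℓ i → ≤-trans (p≤∣p∣ (μ k (suc i))) (<⇒≤ (μ<ℓ i))) ∣μ∣<ℓ

      -- L exceeds the absolute value of a term of some nontrivial eigenvalue. One exists because d
      -- ≠ 0 rules out a single vertex.
      0<L : 0ℚ < L
      0<L = ≤-<-trans (0≤∣p∣ (μ (proj₁ (sample ∣μ∣<ℓ)) (suc (another-vertex G (regular zero))))) (<-trans (proj₂ (sample ∣μ∣<ℓ) (another-vertex G (regular zero))) ℓ<L)

      L≤Λ+δ : Eventually λ k → L ≤ seq Λ k + δ
      L≤Λ+δ = eventually-map (λ {k} ΛK≈Λk → begin
        seq Λ K + η + η + η
          ≤⟨ +-monoˡ-≤ η (+-monoˡ-≤ η (+-monoˡ-≤ η (<⇒≤ (∣p-q∣<r⇒p<q+r (seq Λ K) (seq Λ k) ΛK≈Λk)))) ⟩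
        seq Λ k + η + η + η + η
          ≡⟨ solve 2 (λ l δ → let η = con ½ :* (con ½ :* δ) in l :+ η :+ η :+ η :+ η := l :+ δ) refl (seq Λ k) δ ⟩
        seq Λ k + δ ∎) close

    -- The factor d cancels against Λ / d, which leaves the bound coming from the quadratic form
    -- with `seq Λ k` in place of L.
    seq-dθ : ∀ m k → seq (fromℕ d ℝ.* θ (suc n) d Λ m) k ≡ density * fromNat m + seq Λ k
    seq-dθ m k = begin
      D * (fromNat m * r + seq Λ k * s)    ≡⟨ solve 5 (λ D m r l s → D :* (m :* r :+ l :* s) := D :* r :* m :+ D :* s :* l)
                                                refl D (fromNat m) r (seq Λ k) s ⟩
      D * r * fromNat m + D * s * seq Λ k  ≡⟨ cong (λ p → D * r * fromNat m + p * seq Λ k) (fromNat-inverse d) ⟩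
      D * r * fromNat m + 1ℚ * seq Λ k     ≡⟨ cong (D * r * fromNat m +_) (*-identityˡ (seq Λ k)) ⟩
      D * r * fromNat m + seq Λ k          ∎
      where
      open ≡-Reasoning
      D r s : ℚ
      D = fromNat d
      r = ℤ.+ 1 / suc n
      s = ℤ.+ 1 / d

    0≤density*m : ∀ m → 0ℚ ≤ density * fromNat m
    0≤density*m m = 0≤* (0≤* (0≤fromNat d) (0≤1/ (suc n))) (0≤fromNat m)

    -- The order of the choices matters: ε determines δ, and δ determines L. With L fixed, `c≤` is
    -- an inequality between rationals free of k; the index enters only when L is compared with
    -- `seq Λ k + δ`.
    cliqueCount-≤ : ∀ i B → let instance _ = suc i ℕ.!≢0 in
      fromℕ (cliqueCount G (suc i) B) ℝ.≤
        (fromℕ (size B) ÷ suc i !) ℝ.* (fromℕ d ℝ.* θ (suc n) d Λ (size B)) ℝ.^ i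
    cliqueCount-≤ i B ε 0<ε = eventually-map eventual (Λ≤Y & L≤Λ+δ)
      where
      open ≤-Reasoning
      instance
        _ = suc i ℕ.!≢0
      m f r : ℚ
      m = fromNat (size B)
      f = ℤ.+ 1 / suc i !
      r = m * f
      y : ℕ → ℚ
      y k = density * m + seq Λ k
      c = cliqueCount G (suc i) B

      Y : ℚ
      Y = proj₁ (bounded-seq Λ)

      0≤Y : 0ℚ ≤ Y
      0≤Y = proj₁ (proj₂ (bounded-seq Λ))

      Λ≤Y : Eventually λ k → ∣ seq Λ k ∣ ≤ Y
      Λ≤Y = proj₂ (proj₂ (bounded-seq Λ))

      0≤r : 0ℚ ≤ r
      0≤r = 0≤* (0≤fromNat (size B)) (0≤1/ (suc i !))

      perturb : ∃[ δ ] (0ℚ < δ × (∀ x → ∣ x ∣ ≤ density * m + Y → r * (x + δ) ^ i < r * x ^ i + ε))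
      perturb = perturbation (0≤+ (0≤density*m (size B)) 0≤Y) 0≤r 0<ε i

      δ : ℚ
      δ = proj₁ perturb

      gap : ∃[ L ] (0ℚ < L × deflated (adjacencyℚ G) density ≼ L × Eventually λ k → L ≤ seq Λ k + δ)
      gap = spectral-gap (proj₁ (proj₂ perturb))

      L : ℚ
      L = proj₁ gap

      0<L : 0ℚ < L
      0<L = proj₁ (proj₂ gap)

      A≼L : deflated (adjacencyℚ G) density ≼ L
      A≼L = proj₁ (proj₂ (proj₂ gap))

      L≤Λ+δ : Eventually λ k → L ≤ seq Λ k + δ
      L≤Λ+δ = proj₂ (proj₂ (proj₂ gap))

      z : ℕ → ℚ
      z k = density * fromNat k + L

      0≤z : ∀ k → 0ℚ ≤ z k
      0≤z k = 0≤+ (0≤density*m k) (<⇒≤ 0<L)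

      z-mono : ∀ {k l} → k ℕ.≤ l → z k ≤ z l
      z-mono k≤l = +-monoˡ-≤ L (*-monoˡ-≤ (0≤* (0≤fromNat d) (0≤1/ (suc n))) (fromNat-mono k≤l))

      c≤ : fromNat c ≤ r * z (size B) ^ i
      c≤ = begin
        fromNat c                                  ≡⟨ *-identityˡ (fromNat c) ⟨
        1ℚ * fromNat c                             ≡⟨ cong (_* fromNat c) (fromNat-inverse (suc i !)) ⟨
        fromNat (suc i !) * f * fromNat c          ≡⟨ solve 3 (λ p f c → p :* f :* c := f :* (p :* c)) refl (fromNat (suc i !)) f (fromNat c) ⟩
        f * (fromNat (suc i !) * fromNat c)        ≡⟨ cong (f *_) (fromNat-* (suc i !) c) ⟨
        f * fromNat (suc i ! ℕ.* c)                ≤⟨ *-monoˡ-≤ (0≤1/ (suc i !)) (cliqueCount-bound G z 0≤z z-mono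
                                                        (internalDegrees-bound G A≼L) i B) ⟩
        f * (m * z (size B) ^ i)                   ≡⟨ solve 3 (λ f m p → f :* (m :* p) := m :* f :* p) refl f m (z (size B) ^ i) ⟩
        r * z (size B) ^ i                         ∎

      eventual : ∀ {k} → ∣ seq Λ k ∣ ≤ Y × L ≤ seq Λ k + δ →
        fromNat c < r * seq ((fromℕ d ℝ.* θ (suc n) d Λ (size B)) ℝ.^ i) k + ε
      eventual {k} (Λ≤Y , L≤Λ+δ) = begin-strict
        fromNat c
          ≤⟨ c≤ ⟩
        r * z (size B) ^ i
          ≤⟨ *-monoˡ-≤ 0≤r (^-mono i (0≤z (size B)) (≤-trans (+-monoʳ-≤ (density * m) L≤Λ+δ)
               (≤-reflexive (sym (+-assoc (density * m) (seq Λ k) δ))))) ⟩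
        r * (y k + δ) ^ i
          <⟨ proj₂ (proj₂ perturb) (y k) (≤-trans (∣p+q∣≤∣p∣+∣q∣ (density * m) (seq Λ k))
               (+-mono-≤ (≤-reflexive (0≤p⇒∣p∣≡p (0≤density*m (size B)))) Λ≤Y)) ⟩
        r * y k ^ i + ε
          ≡⟨ cong (λ p → r * p + ε) (trans (seq-^ (fromℕ d ℝ.* θ (suc n) d Λ (size B)) i k)
               (cong (_^ i) (seq-dθ (size B) k))) ⟨
        r * seq ((fromℕ d ℝ.* θ (suc n) d Λ (size B)) ℝ.^ i) k + ε ∎

  ≤-respʳ : ∀ {x y z} → (∀ k → seq y k ≡ seq z k) → x ℝ.≤ y → x ℝ.≤ z
  ≤-respʳ {x} y≡z x≤y ε 0<ε = eventually-map (λ {k} → subst (λ p → seq x k < p + ε) (y≡z k)) (x≤y ε 0<ε)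

  edge-bound≡ : ∀ n d {{_ : ℕ.NonZero n}} {{_ : ℕ.NonZero d}} Λ m k →
    seq ((fromℕ m ÷ 2) ℝ.* (fromℕ d ℝ.* θ n d Λ m) ℝ.^ 1) k ≡
    seq (fromℕ (d ℕ.* m) ÷ 2 ℝ.* (fromℕ m ÷ n ℝ.+ Λ ÷ d)) k
  edge-bound≡ n d Λ m k = begin
    fromNat m * h * (fromNat d * t * 1ℚ)
      ≡⟨ solve 4 (λ m h d t → m :* h :* (d :* t :* con 1ℚ) := d :* m :* h :* t) refl (fromNat m) h (fromNat d) t ⟩
    fromNat d * fromNat m * h * t
      ≡⟨ cong (λ p → p * h * t) (fromNat-* d m) ⟨
    fromNat (d ℕ.* m) * h * t ∎
    where
    open ≡-Reasoning
    h t : ℚ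
    h = ℤ.+ 1 / 2
    t = seq (θ n d Λ m) k

open import Defs
open import Data.Fin.Subset using (Subset; ∣_∣)
open import Data.Nat.Base using (NonZero; _∸_; _!)
open import Data.Nat.Properties using (_!≢0)
open Counting using (cliqueCount-2)
open RealBounds using (cliqueCount-≤; ≤-respʳ; edge-bound≡)

proposition3p2 :
  (n d : ℕ) {{_ : NonZero n}} {{_ : NonZero d}} (Λ : ℝ) (G : Graph n) →
  IsNDΛGraph G d Λ →
  (B : Subset n) (m : ℕ) → ∣ B ∣ ≡ m →
  (∀ i → 2 ℕ.≤ i →
    fromℕ (cliqueCount G i B)
      ≤ (fromℕ m ÷ i !) {{i !≢0}} * (fromℕ d * θ n d Λ m) ^ (i ∸ 1))
  × cliqueCount G 2 B ≡ edgeCount G B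
  × fromℕ (edgeCount G B) ≤ fromℕ (d ℕ.* m) ÷ 2 * (fromℕ m ÷ n + Λ ÷ d)
proposition3p2 zero = λ d {{n≢0}} → contradiction refl (ℕ.≢-nonZero⁻¹ 0 {{n≢0}})
proposition3p2 (suc n) d Λ G ndΛ B .(∣ B ∣) refl =
    -- Writing the index as `suc i` makes the exponent compute to i; index 0 is excluded by the
    -- hypothesis 2 ≤ i.
    (λ { (suc i) 2≤i → cliqueCount-≤ G ndΛ i B })
  , cliqueCount-2 G B
  -- The case i = 2 of the clique bound, where 2! computes to 2 and the exponent is 1, with its
  -- right-hand side rearranged termwise.
  , subst (λ e → fromℕ e ≤ fromℕ (d ℕ.* ∣ B ∣) ÷ 2 * (fromℕ ∣ B ∣ ÷ suc n + Λ ÷ d)) (cliqueCount-2 G B)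
      (≤-respʳ {fromℕ (cliqueCount G 2 B)}
        {(fromℕ ∣ B ∣ ÷ 2) * (fromℕ d * θ (suc n) d Λ ∣ B ∣) ^ 1}
        {fromℕ (d ℕ.* ∣ B ∣) ÷ 2 * (fromℕ ∣ B ∣ ÷ suc n + Λ ÷ d)}
        (edge-bound≡ (suc n) d Λ ∣ B ∣) (cliqueCount-≤ G ndΛ 1 B))
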